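{- Let $f(Z)=\sum_{\alpha\in A} c_\alpha Z^\alpha+\sum_{\beta\in B} c_\beta Z^\beta \in \mathbb{C}[Z]$ be a homogeneous non-mixed polynomial of degree $d\ge 3$ on the space of complex symmetric $n\times n$ matrices, where $A$ is the set of exponent matrices of diagonal monomials and $B$ is the set of exponent matrices of off-diagonal monomials. Assume that $c_\beta\neq 0$ for some $\beta\in B$. Then $f$ is not psd-stable.
   Context: $\mathbb{C}[Z]$ denotes the ring of polynomials in the entries $z_{ij}$ of a symmetric $n\times n$ variable matrix $Z=(z_{ij})$, with $z_{ij}$ and $z_{ji}$ identified. Monomials are written $Z^\alpha=\prod_{1\le i,j\le n} z_{ij}^{\alpha_{ij}}$, where $\alpha$ is a symmetric matrix with non-negative entries, whose diagonal entries are integers and whose off-diagonal entries are half-integers (so for $i<j$ the variable $z_{ij}$ has exponent $2\alpha_{ij}$). A monomial $Z^\alpha$ is diagonal if $\alpha_{ij}=0$ for all $i\ne j$, and off-diagonal if $\alpha_{ii}=0$ for all $i$; by convention a constant is a diagonal monomial but not an off-diagonal one. A polynomial is non-mixed if every monomial occurring in it is either diagonal or off-diagonal. A polynomial $f\in\mathbb{C}[Z]$ is psd-stable if $f(M)\ne 0$ for every complex symmetric $n\times n$ matrix $M$ whose entrywise imaginary part $\mathrm{Im}(M)$ is positive definite. -}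

module Defs where

open import Algebra.Bundles using (CommutativeRing; RawMonoid; RawRing)
import Algebra.Definitions.RawMonoid as MonoidOps
import Algebra.Definitions.RawSemiring as SemiringOps
open import Data.Bool.Base using (if_then_else_)
open import Data.Fin.Base using (Fin)
open import Data.Fin.Properties using (_≤?_)
open import Data.List.Base using (List; foldr; map)
open import Data.List.Membership.Propositional using (_∈_)
open import Data.List.Relation.Unary.AllPairs using (AllPairs)
open import Data.Nat.Base as ℕ using (ℕ)
open import Data.Product.Base using (_×_; _,_; ∃; proj₂)
open import Data.Sum.Base using (_⊎_)
open import Level using (Level; _⊔_; suc)
open import Relation.Binary.Core using (Rel)
import Relation.Binary.Construct.StrictToNonStrict as NonStrict
open import Relation.Binary.PropositionalEquality.Core using (_≡_; _≢_)
open import Relation.Binary.Structures using (IsStrictTotalOrder)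
open import Relation.Nullary.Decidable.Core using (does)
open import Relation.Nullary.Negation.Core using (¬_)
open import Relation.Unary using (Pred; Satisfiable)

-- The classical axioms that determine ℝ up to isomorphism.  There is no
-- library ℝ, so everything below is stated over an arbitrary model of them.
record CompleteOrderedField (c ℓ₁ ℓ₂ : Level) : Set (suc (c ⊔ ℓ₁ ⊔ ℓ₂)) where
  infix 4 _<_
  field
    commutativeRing : CommutativeRing c ℓ₁

  open CommutativeRing commutativeRing public

  field
    1≉0     : 1# ≉ 0#
    inverse : ∀ x → x ≉ 0# → ∃ λ y → x * y ≈ 1#

    _<_                : Rel Carrier ℓ₂
    isStrictTotalOrder : IsStrictTotalOrder _≈_ _<_
    +-monoˡ-<          : ∀ z {x y} → x < y → x + z < y + z
    *-positive         : ∀ {x y} → 0# < x → 0# < y → 0# < x * y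

  open NonStrict _≈_ _<_ public using (_≤_)

  UpperBound : ∀ {p} → Pred Carrier p → Carrier → Set (c ⊔ ℓ₁ ⊔ ℓ₂ ⊔ p)
  UpperBound S b = ∀ {x} → S x → x ≤ b

  field
    supremum : (S : Pred Carrier (c ⊔ ℓ₁ ⊔ ℓ₂)) →
               Satisfiable S → Satisfiable (UpperBound S) →
               ∃ λ s → UpperBound S s × (∀ b → UpperBound S b → s ≤ b)

Matrix : ∀ {a} → Set a → ℕ → Set a
Matrix A n = Fin n → Fin n → A

-- Combines the entries at positions (i , j) with i ≤ j, i.e. one entry for
-- each variable z_ij of a symmetric matrix.
module _ {a ℓ} (M : RawMonoid a ℓ) where
  open RawMonoid M
  open MonoidOps M using (sum)

  upperFold : ∀ {n} → Matrix Carrier n → Carrier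
  upperFold X = sum λ i → sum λ j → if does (i ≤? j) then X i j else ε

-- The half-integral matrix α is stored through the exponents of the
-- variables in Z^α: exponent i i = α_ii, and exponent i j = 2α_ij for i ≠ j
-- (α_ij + α_ji, as z_ij and z_ji are the same variable).
record Exponent (n : ℕ) : Set where
  field
    exponent  : Matrix ℕ n
    symmetric : ∀ i j → exponent i j ≡ exponent j i

open Exponent public

infix 4 _≐_
_≐_ : ∀ {n} → Exponent n → Exponent n → Set
α ≐ β = ∀ i j → exponent α i j ≡ exponent β i j

degree : ∀ {n} → Exponent n → ℕ
degree α = upperFold ℕ.+-0-rawMonoid (exponent α)

Diagonal : ∀ {n} → Exponent n → Set
Diagonal α = ∀ i j → i ≢ j → exponent α i j ≡ 0

-- The second conjunct excludes the constant monomial.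
OffDiagonal : ∀ {n} → Exponent n → Set
OffDiagonal α = (∀ i → exponent α i i ≡ 0) × ¬ (∀ i j → exponent α i j ≡ 0)

module _ {c ℓ₁ ℓ₂} (R : CompleteOrderedField c ℓ₁ ℓ₂) where
  private
    module R = CompleteOrderedField R
    module RSum = MonoidOps R.+-rawMonoid

  record ℂ : Set c where
    constructor _+i_
    field
      re im : R.Carrier

  open ℂ public

  ℂ-rawRing : RawRing c ℓ₁
  ℂ-rawRing = record
    { Carrier = ℂ
    ; _≈_     = λ z w → re z R.≈ re w × im z R.≈ im w
    ; _+_     = λ z w → (re z R.+ re w) +i (im z R.+ im w)
    ; _*_     = λ z w → (re z R.* re w R.- im z R.* im w)
                     +i (re z R.* im w R.+ im z R.* re w)
    ; -_      = λ z → (R.- re z) +i (R.- im z)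
    ; 0#      = R.0# +i R.0#
    ; 1#      = R.1# +i R.0#
    }

  private
    module C where
      open RawRing ℂ-rawRing public
      open SemiringOps rawSemiring public using (_^_)

  -- Coefficients in the list may be zero; the exponents are pairwise distinct,
  -- so each listed coefficient is the coefficient of its monomial.
  record Polynomial (n : ℕ) : Set c where
    field
      terms    : List (ℂ × Exponent n)
      distinct : AllPairs (λ α β → ¬ α ≐ β) (map proj₂ terms)

  open Polynomial public

  Occurs : ∀ {n} → Exponent n → Polynomial n → Set (c ⊔ ℓ₁)
  Occurs α f = ∃ λ a → (a , α) ∈ terms f × a C.≉ C.0#

  Homogeneous : ∀ {n} → ℕ → Polynomial n → Set (c ⊔ ℓ₁)
  Homogeneous d f = ∀ α → Occurs α f → degree α ≡ d

  NonMixed : ∀ {n} → Polynomial n → Set (c ⊔ ℓ₁)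
  NonMixed f = ∀ α → Occurs α f → Diagonal α ⊎ OffDiagonal α

  monomial : ∀ {n} → Exponent n → Matrix ℂ n → ℂ
  monomial α M = upperFold C.*-rawMonoid λ i j → M i j C.^ exponent α i j

  eval : ∀ {n} → Polynomial n → Matrix ℂ n → ℂ
  eval f M = foldr (λ (a , α) s → a C.* monomial α M C.+ s) C.0# (terms f)

  Symmetric : ∀ {n} → Matrix ℂ n → Set ℓ₁
  Symmetric M = ∀ i j → M i j C.≈ M j i

  Im : ∀ {n} → Matrix ℂ n → Matrix R.Carrier n
  Im M i j = im (M i j)

  -- Only applied to symmetric matrices.
  PositiveDefinite : ∀ {n} → Matrix R.Carrier n → Set (c ⊔ ℓ₁ ⊔ ℓ₂)
  PositiveDefinite {n} Y =
    ∀ (x : Fin n → R.Carrier) → ¬ (∀ i → x i R.≈ R.0#) →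
    R.0# R.< RSum.sum λ i → RSum.sum λ j → x i R.* Y i j R.* x j

  PsdStable : ∀ {n} → Polynomial n → Set (c ⊔ ℓ₁ ⊔ ℓ₂)
  PsdStable f =
    ∀ M → Symmetric M → PositiveDefinite (Im M) → eval f M C.≉ C.0#

{-# OPTIONS --safe #-}
-- Write f = p + q with p diagonal and q off-diagonal.  For a real symmetric
-- matrix W with zero diagonal, homogeneity and non-mixedness give
-- f(τ I + s W) = τᵈ f(I) + sᵈ f(W).  If f is psd-stable then f(I) ≠ 0, and if
-- moreover f(W) ≠ 0, then, since d ≥ 3, some τ in the open upper half-plane and
-- s = ±1 annihilate the right-hand side although Im(τ I + s W) = Im(τ) I is
-- positive definite.  Hence q = f vanishes at all such W, and Dedekind's
-- independence of characters, applied to the monomials, shows q = 0.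
--
-- No trigonometry is available to produce τ.  Up to positive scaling one needs
-- a real x with c (x + i)ᵈ on the real axis; the intermediate value theorem
-- provides it for d = 2 and d = 3, and d = 2m and d = 2m + 1 reduce to m by
-- taking a square root of c.
module Submission where

open import Defs
open import Algebra.Bundles using (CommutativeMonoid; CommutativeRing; RawRing)
open import Data.Bool.Base using (if_then_else_; true; false)
open import Data.Empty using (⊥; ⊥-elim)
open import Data.Fin.Base as Fin using (Fin) renaming (_≤_ to _≤ᶠ_)
import Data.Fin.Properties as Fin
open import Data.Integer.Base as ℤ using (ℤ; +_; -[1+_])
import Data.Integer.Properties as ℤ
open import Data.List.Base using (List; []; _∷_; foldr; map)
open import Data.List.Membership.Propositional using (_∈_)
open import Data.List.Relation.Unary.All using (All; []; _∷_)
open import Data.List.Relation.Unary.AllPairs using (AllPairs; []; _∷_)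
open import Data.List.Relation.Unary.Any using (here; there)
import Data.Maybe.Base as Maybe
open import Data.Nat.Base as ℕ using (ℕ; zero; suc; z≤n; s≤s; _≥_)
open import Data.Nat.Induction using (<-rec)
import Data.Nat.Properties as ℕ
open import Data.Product.Base using (_×_; _,_; ∃; proj₁; proj₂)
open import Data.Sum.Base using (_⊎_; inj₁; inj₂; [_,_]′)
open import Function.Base using (_∘_)
open import Level using (Lift; lift; _⊔_)
open import Relation.Binary.Definitions using (tri<; tri≈; tri>)
open import Relation.Binary.PropositionalEquality.Core as ≡ using (_≡_; _≢_)
open import Relation.Binary.Structures using (IsStrictTotalOrder)
open import Relation.Nullary.Decidable.Core using (Dec; yes; no; does; dec⇒maybe; _×-dec_)
open import Relation.Nullary.Negation.Core using (¬_; contradiction)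
open import Relation.Unary using (Pred)

-- The role of d ≥ 3 is a matter of angles. As x runs through the reals, `(x + i)^d` sweeps an open
-- angle of size dπ. For d = 2 this is every direction except the positive real axis, and the
-- theorem does fail there: the 2 × 2 determinant z₁₁ z₂₂ - z₁₂² is homogeneous, non-mixed and
-- psd-stable. From d = 3 on every direction is met.
--
-- The same count limits the descent from d to m: in degree 1 with c = 1 the point x + i is never
-- real, so 2 and 3 have to be settled by hand and doubling may only start from m ≥ 2.
--
-- All functions fed to the intermediate value theorem are polynomials in one real variable, so
-- continuity is replaced by a Lipschitz bound with explicit constants. A bound on the values is
-- carried along because the Lipschitz constant of a product involves it.
--
-- Every case distinction is decided by trichotomy of the order or by finiteness of index sets, so
-- excluded middle is never invoked.

-- Ring solver with integer coefficients over an arbitrary commutative ring.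

module IntegerCoefficients {a ℓ} (R : CommutativeRing a ℓ) where
  open CommutativeRing R
  open import Algebra.Properties.Ring ring
  open import Algebra.Properties.Semiring.Mult.TCOptimised semiring using (1+×; ×-homo-+; ×1-homo-*)
    renaming (_×_ to _·_)
  open import Algebra.Solver.Ring.AlmostCommutativeRing
  open import Relation.Binary.Reasoning.Setoid setoid

  -- With the optimised multiple, `1 · 1#` reduces to `1#`, so `con (+ 0)` and `con (+ 1)` in solver
  -- calls denote `0#` and `1#` definitionally. Integers are used as coefficients because their
  -- arithmetic and equality test compute, unlike those of an abstract ring.
  fromℤ : ℤ → Carrier
  fromℤ (+ n)    = n · 1#
  fromℤ -[1+ n ] = - (suc n · 1#)

  fromℤ-⊖ : ∀ m n → fromℤ (m ℤ.⊖ n) ≈ m · 1# - n · 1#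
  fromℤ-⊖ m       zero    = sym (trans (+-congˡ -0#≈0#) (+-identityʳ _))
  fromℤ-⊖ zero    (suc n) = sym (+-identityˡ _)
  fromℤ-⊖ (suc m) (suc n) = begin
    fromℤ (suc m ℤ.⊖ suc n)               ≡⟨ ≡.cong fromℤ (ℤ.[1+m]⊖[1+n]≡m⊖n m n) ⟩
    fromℤ (m ℤ.⊖ n)                       ≈⟨ fromℤ-⊖ m n ⟩
    m · 1# - n · 1#                       ≈⟨ +-congʳ (xyx⁻¹≈y 1# (m · 1#)) ⟨
    (1# + m · 1# - 1#) - n · 1#           ≈⟨ +-assoc _ _ _ ⟩
    (1# + m · 1#) + (- 1# - n · 1#)       ≈⟨ +-congˡ (-‿+-comm 1# (n · 1#)) ⟩
    (1# + m · 1#) - (1# + n · 1#)         ≈⟨ +-cong (1+× m 1#) (-‿cong (1+× n 1#)) ⟨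
    suc m · 1# - suc n · 1#               ∎

  fromℤ-neg : ∀ i → fromℤ (ℤ.- i) ≈ - fromℤ i
  fromℤ-neg (+ zero)  = sym -0#≈0#
  fromℤ-neg (+ suc n) = refl
  fromℤ-neg -[1+ n ]  = sym (-‿involutive _)

  fromℤ-+ : ∀ i j → fromℤ (i ℤ.+ j) ≈ fromℤ i + fromℤ j
  fromℤ-+ (+ m)    (+ n)    = ×-homo-+ 1# m n
  fromℤ-+ (+ m)    -[1+ n ] = fromℤ-⊖ m (suc n)
  fromℤ-+ -[1+ m ] (+ n)    = trans (fromℤ-⊖ n (suc m)) (+-comm _ _)
  fromℤ-+ i@(-[1+ m ]) j@(-[1+ n ]) = begin
    fromℤ (i ℤ.+ j)                ≡⟨ ≡.cong fromℤ (ℤ.neg-distrib-+ (+ suc m) (+ suc n)) ⟨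
    fromℤ (ℤ.- (+ suc m ℤ.+ + suc n)) ≈⟨ fromℤ-neg (+ suc m ℤ.+ + suc n) ⟩
    - ((suc m ℕ.+ suc n) · 1#)        ≈⟨ -‿cong (×-homo-+ 1# (suc m) (suc n)) ⟩
    - (suc m · 1# + suc n · 1#)    ≈⟨ -‿+-comm _ _ ⟨
    fromℤ i + fromℤ j              ∎

  fromℤ-*-pos : ∀ i n → fromℤ (i ℤ.* + n) ≈ fromℤ i * n · 1#
  fromℤ-*-pos (+ m) n = begin
    fromℤ (+ m ℤ.* + n) ≡⟨ ≡.cong fromℤ (ℤ.pos-* m n) ⟨
    (m ℕ.* n) · 1#      ≈⟨ ×1-homo-* m n ⟩
    m · 1# * n · 1#     ∎
  fromℤ-*-pos i@(-[1+ m ]) n = begin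
    fromℤ (i ℤ.* + n)             ≡⟨ ≡.cong fromℤ (ℤ.neg-distribˡ-* (+ suc m) (+ n)) ⟨
    fromℤ (ℤ.- (+ suc m ℤ.* + n)) ≈⟨ fromℤ-neg (+ suc m ℤ.* + n) ⟩
    - fromℤ (+ suc m ℤ.* + n)     ≈⟨ -‿cong (fromℤ-*-pos (+ suc m) n) ⟩
    - (suc m · 1# * n · 1#)       ≈⟨ -‿distribˡ-* _ _ ⟩
    fromℤ i * n · 1#              ∎

  fromℤ-* : ∀ i j → fromℤ (i ℤ.* j) ≈ fromℤ i * fromℤ j
  fromℤ-* i (+ n) = fromℤ-*-pos i n
  fromℤ-* i j@(-[1+ n ]) = begin
    fromℤ (i ℤ.* j)             ≡⟨ ≡.cong fromℤ (ℤ.neg-distribʳ-* i (+ suc n)) ⟨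
    fromℤ (ℤ.- (i ℤ.* + suc n)) ≈⟨ fromℤ-neg (i ℤ.* + suc n) ⟩
    - fromℤ (i ℤ.* + suc n)     ≈⟨ -‿cong (fromℤ-*-pos i (suc n)) ⟩
    - (fromℤ i * suc n · 1#)    ≈⟨ -‿distribʳ-* _ _ ⟩
    fromℤ i * fromℤ j           ∎

  ℤ⟶R : CommutativeRing.rawRing ℤ.+-*-commutativeRing -Raw-AlmostCommutative⟶ fromCommutativeRing R
  ℤ⟶R = record
    { ⟦_⟧    = fromℤ
    ; +-homo = fromℤ-+
    ; *-homo = fromℤ-*
    ; -‿homo = fromℤ-neg
    ; 0-homo = refl
    ; 1-homo = refl
    }

  open import Algebra.Solver.Ring
    (CommutativeRing.rawRing ℤ.+-*-commutativeRing) (fromCommutativeRing R) ℤ⟶R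
    (λ i j → Maybe.map (λ i≡j → reflexive (≡.cong fromℤ i≡j)) (dec⇒maybe (i ℤ.≟ j))) public

-- Order arithmetic and Lipschitz bounds in a complete ordered field.

module OrderedField {c ℓ₁ ℓ₂} (R : CompleteOrderedField c ℓ₁ ℓ₂) where
  open CompleteOrderedField R hiding (zero)
  module < = IsStrictTotalOrder isStrictTotalOrder
  open IntegerCoefficients commutativeRing using (solve; _:=_; _:+_; _:*_; _:-_; :-_; con)

  <-respʳ : ∀ {x y z} → y ≈ z → x < y → x < z
  <-respʳ = <.<-respʳ-≈

  ≤-respʳ : ∀ {x y z} → y ≈ z → x ≤ y → x ≤ z
  ≤-respʳ e (inj₁ p) = inj₁ (<-respʳ e p)
  ≤-respʳ e (inj₂ p) = inj₂ (trans p e)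

  x<y⇒0<y-x : ∀ {x y} → x < y → 0# < y - x
  x<y⇒0<y-x {x} p = <.<-respˡ-≈ (-‿inverseʳ x) (+-monoˡ-< (- x) p)

  0<y-x⇒x<y : ∀ {x y} → 0# < y - x → x < y
  0<y-x⇒x<y {x} {y} p = <.<-respˡ-≈ (+-identityˡ x)
    (<-respʳ (solve 2 (λ x y → y :- x :+ x := y) refl x y) (+-monoˡ-< x p))

  x≤y⇒0≤y-x : ∀ {x y} → x ≤ y → 0# ≤ y - x
  x≤y⇒0≤y-x (inj₁ p) = inj₁ (x<y⇒0<y-x p)
  x≤y⇒0≤y-x {x} (inj₂ p) = inj₂ (sym (trans (+-congʳ (sym p)) (-‿inverseʳ x)))

  0≤y-x⇒x≤y : ∀ {x y} → 0# ≤ y - x → x ≤ y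
  0≤y-x⇒x≤y (inj₁ p) = inj₁ (0<y-x⇒x<y p)
  0≤y-x⇒x≤y {x} {y} (inj₂ p) = inj₂ (trans (sym (+-identityˡ x)) (trans (+-congʳ p)
    (solve 2 (λ x y → y :- x :+ x := y) refl x y)))

  x<0⇒0<-x : ∀ {x} → x < 0# → 0# < - x
  x<0⇒0<-x {x} p = <-respʳ (+-identityˡ (- x)) (x<y⇒0<y-x p)

  x≤0⇒0≤-x : ∀ {x} → x ≤ 0# → 0# ≤ - x
  x≤0⇒0≤-x {x} p = ≤-respʳ (+-identityˡ (- x)) (x≤y⇒0≤y-x p)

  <-irrefl : ∀ {x} → ¬ (x < x)
  <-irrefl = <.irrefl refl

  0<⇒≉0 : ∀ {x} → 0# < x → x ≉ 0#
  0<⇒≉0 p e = <.irrefl (sym e) p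

  <-≤-trans : ∀ {x y z} → x < y → y ≤ z → x < z
  <-≤-trans p (inj₁ q) = <.trans p q
  <-≤-trans p (inj₂ q) = <-respʳ q p

  ≤-<-connex : ∀ x y → x ≤ y ⊎ y < x
  ≤-<-connex x y with <.compare x y
  ... | tri< p _ _ = inj₁ (inj₁ p)
  ... | tri≈ _ p _ = inj₁ (inj₂ p)
  ... | tri> _ _ p = inj₂ p

  0<-+ : ∀ {x y} → 0# < x → 0# ≤ y → 0# < x + y
  0<-+ {x} {y} p (inj₁ q) = <.trans q (<.<-respˡ-≈ (+-identityˡ y) (+-monoˡ-< y p))
  0<-+ {x} {y} p (inj₂ q) = <-respʳ (trans (sym (+-identityʳ x)) (+-congˡ q)) p

  0≤-+ : ∀ {x y} → 0# ≤ x → 0# ≤ y → 0# ≤ x + y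
  0≤-+ (inj₁ p) q = inj₁ (0<-+ p q)
  0≤-+ {x} {y} (inj₂ p) q = ≤-respʳ (trans (sym (+-identityˡ y)) (+-congʳ p)) q

  0≤-* : ∀ {x y} → 0# ≤ x → 0# ≤ y → 0# ≤ x * y
  0≤-* (inj₁ p) (inj₁ q) = inj₁ (*-positive p q)
  0≤-* {x} {y} (inj₂ p) _ = inj₂ (trans (sym (zeroˡ y)) (*-congʳ p))
  0≤-* {x} {y} (inj₁ _) (inj₂ q) = inj₂ (trans (sym (zeroʳ x)) (*-congˡ q))

  0<x² : ∀ {x} → x ≉ 0# → 0# < x * x
  0<x² {x} x≉0 with <.compare 0# x
  ... | tri< p _ _ = *-positive p p
  ... | tri≈ _ p _ = contradiction (sym p) x≉0
  ... | tri> _ _ p = <-respʳ (solve 1 (λ x → (:- x) :* (:- x) := x :* x) refl x)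
                       (*-positive (x<0⇒0<-x p) (x<0⇒0<-x p))

  0≤x² : ∀ x → 0# ≤ x * x
  0≤x² x with x <.≟ 0#
  ... | no p = inj₁ (0<x² p)
  ... | yes p = inj₂ (sym (trans (*-congʳ p) (zeroˡ x)))

  0<1 : 0# < 1#
  0<1 = <-respʳ (*-identityˡ 1#) (0<x² 1≉0)

  0<⇒inverse : ∀ {x} → 0# < x → ∃ λ y → 0# < y × x * y ≈ 1#
  0<⇒inverse {x} p with inverse x (0<⇒≉0 p)
  ... | y , xy≈1 with <.compare 0# y
  ...   | tri< q _ _ = y , q , xy≈1
  ...   | tri≈ _ q _ = contradiction (trans (sym xy≈1) (trans (*-congˡ (sym q)) (zeroʳ x))) 1≉0
  ...   | tri> _ _ q = ⊥-elim (<-irrefl (<-respʳ e (0<-+ (*-positive p (x<0⇒0<-x q)) (inj₁ 0<1))))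
    where
    e : x * - y + 1# ≈ 0#
    e = trans (+-congˡ (sym xy≈1)) (solve 2 (λ x y → x :* (:- y) :+ x :* y := con (+ 0)) refl x y)

  -- On [0,1]; both conditions are squared to avoid absolute values.
  record Lipschitz (f : Carrier → Carrier) : Set (c ⊔ ℓ₁ ⊔ ℓ₂) where
    field
      K B : Carrier
      0≤K : 0# ≤ K
      0≤B : 0# ≤ B
      lipschitz : ∀ {x y} → 0# ≤ x → x ≤ 1# → 0# ≤ y → y ≤ 1# →
        0# ≤ K * ((y - x) * (y - x)) - (f y - f x) * (f y - f x)
      bounded : ∀ {x} → 0# ≤ x → x ≤ 1# → 0# ≤ B - f x * f x

  open Lipschitz

  const-lipschitz : ∀ a → Lipschitz (λ _ → a)
  const-lipschitz a = record
    { K = 0# ; B = a * a ; 0≤K = inj₂ refl ; 0≤B = 0≤x² a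
    ; lipschitz = λ {x} {y} _ _ _ _ → inj₂
        (solve 3 (λ x y a → con (+ 0) := con (+ 0) :* ((y :- x) :* (y :- x)) :- (a :- a) :* (a :- a)) refl x y a)
    ; bounded = λ _ _ → inj₂ (sym (-‿inverseʳ _))
    }

  id-lipschitz : Lipschitz (λ x → x)
  id-lipschitz = record
    { K = 1# ; B = 1# ; 0≤K = inj₁ 0<1 ; 0≤B = inj₁ 0<1
    ; lipschitz = λ {x} {y} _ _ _ _ → inj₂
        (solve 2 (λ x y → con (+ 0) := con (+ 1) :* ((y :- x) :* (y :- x)) :- (y :- x) :* (y :- x)) refl x y)
    ; bounded = λ {x} 0≤x x≤1 → ≤-respʳ
        (solve 1 (λ x → (con (+ 1) :- x) :* (con (+ 1) :+ x) := con (+ 1) :- x :* x) refl x)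
        (0≤-* (x≤y⇒0≤y-x x≤1) (0≤-+ (inj₁ 0<1) 0≤x))
    }

  -‿lipschitz : ∀ {f} → Lipschitz f → Lipschitz (λ x → - f x)
  -‿lipschitz {f} F = record
    { K = K F ; B = B F ; 0≤K = 0≤K F ; 0≤B = 0≤B F
    ; lipschitz = λ {x} {y} p q r s → ≤-respʳ
        (solve 3 (λ D f g → D :- (g :- f) :* (g :- f) := D :- ((:- g) :- (:- f)) :* ((:- g) :- (:- f)))
          refl _ (f x) (f y))
        (lipschitz F p q r s)
    ; bounded = λ {x} p q → ≤-respʳ
        (solve 2 (λ B f → B :- f :* f := B :- (:- f) :* (:- f)) refl (B F) (f x)) (bounded F p q)
    }

  -- Both constants double because (P + Q)² ≤ 2P² + 2Q²; the slack is the square (P - Q)², the last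
  -- summand of each certificate.
  +-lipschitz : ∀ {f g} → Lipschitz f → Lipschitz g → Lipschitz (λ x → f x + g x)
  +-lipschitz {f} {g} F G = record
    { K = (K F + K F) + (K G + K G) ; B = (B F + B F) + (B G + B G)
    ; 0≤K = 0≤-+ (0≤-+ (0≤K F) (0≤K F)) (0≤-+ (0≤K G) (0≤K G))
    ; 0≤B = 0≤-+ (0≤-+ (0≤B F) (0≤B F)) (0≤-+ (0≤B G) (0≤B G))
    ; lipschitz = λ {x} {y} p q r s → let f′ = lipschitz F p q r s ; g′ = lipschitz G p q r s in ≤-respʳ
        (solve 7 (λ K L D f₁ f₂ g₁ g₂ →
            (K :* D :- (f₂ :- f₁) :* (f₂ :- f₁) :+ (K :* D :- (f₂ :- f₁) :* (f₂ :- f₁)))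
            :+ (L :* D :- (g₂ :- g₁) :* (g₂ :- g₁) :+ (L :* D :- (g₂ :- g₁) :* (g₂ :- g₁)))
            :+ ((f₂ :- f₁) :- (g₂ :- g₁)) :* ((f₂ :- f₁) :- (g₂ :- g₁))
          := ((K :+ K) :+ (L :+ L)) :* D :- ((f₂ :+ g₂) :- (f₁ :+ g₁)) :* ((f₂ :+ g₂) :- (f₁ :+ g₁)))
          refl (K F) (K G) ((y - x) * (y - x)) (f x) (f y) (g x) (g y))
        (0≤-+ (0≤-+ (0≤-+ f′ f′) (0≤-+ g′ g′)) (0≤x² _))
    ; bounded = λ {x} p q → let f′ = bounded F p q ; g′ = bounded G p q in ≤-respʳ
        (solve 4 (λ K L f g →
            (K :- f :* f :+ (K :- f :* f)) :+ (L :- g :* g :+ (L :- g :* g)) :+ (f :- g) :* (f :- g)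
          := (K :+ K) :+ (L :+ L) :- (f :+ g) :* (f :+ g)) refl (B F) (B G) (f x) (g x))
        (0≤-+ (0≤-+ (0≤-+ f′ f′) (0≤-+ g′ g′)) (0≤x² _))
    }

  -- With P = f y − f x and Q = g y − g x the increment of f g is P g y + f x Q,
  -- whose square is at most 2 P² g y² + 2 f x² Q².
  *-lipschitz : ∀ {f g} → Lipschitz f → Lipschitz g → Lipschitz (λ x → f x * g x)
  *-lipschitz {f} {g} F G = record
    { K = (K F * B G + K F * B G) + (B F * K G + B F * K G) ; B = B F * B G
    ; 0≤K = 0≤-+ (0≤-+ (0≤-* (0≤K F) (0≤B G)) (0≤-* (0≤K F) (0≤B G)))
                 (0≤-+ (0≤-* (0≤B F) (0≤K G)) (0≤-* (0≤B F) (0≤K G)))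
    ; 0≤B = 0≤-* (0≤B F) (0≤B G)
    ; lipschitz = λ {x} {y} p q r s →
        let a = 0≤-* (0≤B G) (lipschitz F p q r s)
            b = 0≤-* (0≤x² (f y - f x)) (bounded G r s)
            c = 0≤-* (0≤B F) (lipschitz G p q r s)
            d = 0≤-* (0≤x² (g y - g x)) (bounded F p q)
        in ≤-respʳ (trans
        (solve 9 (λ K L P Q G F D B C →
            ((B :* (K :* D :- P :* P) :+ B :* (K :* D :- P :* P)) :+ (P :* P :* (B :- G :* G) :+ P :* P :* (B :- G :* G)))
            :+ ((C :* (L :* D :- Q :* Q) :+ C :* (L :* D :- Q :* Q)) :+ (Q :* Q :* (C :- F :* F) :+ Q :* Q :* (C :- F :* F)))
            :+ (P :* G :- F :* Q) :* (P :* G :- F :* Q)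
          := ((K :* B :+ K :* B) :+ (C :* L :+ C :* L)) :* D :- (P :* G :+ F :* Q) :* (P :* G :+ F :* Q))
          refl (K F) (K G) (f y - f x) (g y - g x) (g y) (f x) ((y - x) * (y - x)) (B G) (B F))
        (+-congˡ (-‿cong (*-cong (increment (f x) (f y) (g x) (g y)) (increment (f x) (f y) (g x) (g y))))))
        (0≤-+ (0≤-+ (0≤-+ (0≤-+ a a) (0≤-+ b b)) (0≤-+ (0≤-+ c c) (0≤-+ d d))) (0≤x² _))
    ; bounded = λ {x} p q → ≤-respʳ
        (solve 4 (λ K L f g → K :* (L :- g :* g) :+ g :* g :* (K :- f :* f) := K :* L :- f :* g :* (f :* g))
          refl (B F) (B G) (f x) (g x))
        (0≤-+ (0≤-* (0≤B F) (bounded G p q)) (0≤-* (0≤x² (g x)) (bounded F p q)))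
    }
    where
    increment : ∀ f₁ f₂ g₁ g₂ → (f₂ - f₁) * g₂ + f₁ * (g₂ - g₁) ≈ f₂ * g₂ - f₁ * g₁
    increment = solve 4 (λ f₁ f₂ g₁ g₂ → (f₂ :- f₁) :* g₂ :+ f₁ :* (g₂ :- g₁) := f₂ :* g₂ :- f₁ :* g₁) refl

  -- Intermediate value theorem for Lipschitz functions.

  module _ {f : Carrier → Carrier} (F : Lipschitz f) where

    -- Values of opposite sign differ by at least the size of either one, so (f x)² ≤ (f y - f x)²,
    -- and the Lipschitz bound applies.
    sign-change : ∀ {x y} → 0# ≤ x → x ≤ 1# → 0# ≤ y → y ≤ 1# → 0# ≤ - (f x * f y) →
                  0# ≤ K F * ((y - x) * (y - x)) - f x * f x
    sign-change {x} {y} p q r s n = ≤-respʳ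
      (solve 3 (λ D f g → D :- (g :- f) :* (g :- f) :+ g :* g :+ ((:- (f :* g)) :+ (:- (f :* g))) := D :- f :* f)
        refl (K F * ((y - x) * (y - x))) (f x) (f y))
      (0≤-+ (0≤-+ (lipschitz F p q r s) (0≤x² (f y))) (0≤-+ n n))

    -- The witness is e = A/(A + K + 1). Since e < 1, K e² ≤ K e < A.
    modulus : ∀ {A} → 0# < A → ∃ λ e → 0# < e × 0# < A - K F * (e * e)
    modulus {A} 0<A with 0<⇒inverse (0<-+ (0<-+ 0<A (0≤K F)) (inj₁ 0<1))
    ... | v , 0<v , uv≈1 = A * v , *-positive 0<A 0<v , <-respʳ eq
          (*-positive (*-positive 0<A 0<v)
            (0<-+ 0<A (0≤-+ (inj₁ 0<1) (0≤-* (0≤K F) (0≤-* (0≤-+ (0≤K F) (inj₁ 0<1)) (inj₁ 0<v))))))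
      where
      k = K F
      eq : A * v * (A + (1# + k * ((k + 1#) * v))) ≈ A - k * (A * v * (A * v))
      eq = trans
        (solve 3 (λ A k v → A :* v :* (A :+ (con (+ 1) :+ k :* ((k :+ con (+ 1)) :* v)))
            := A :* ((A :+ k :+ con (+ 1)) :* v) :- k :* (A :* v :* (A :* v))
               :+ k :* (A :* v) :* ((A :+ k :+ con (+ 1)) :* v :- con (+ 1))) refl A k v)
        (trans (+-cong (+-congʳ (*-congˡ uv≈1)) (*-congˡ (+-congʳ uv≈1)))
        (solve 3 (λ A k v → A :* con (+ 1) :- k :* (A :* v :* (A :* v)) :+ k :* (A :* v) :* (con (+ 1) :- con (+ 1))
            := A :- k :* (A :* v :* (A :* v))) refl A k v))

    -- The condition |y - x| ≤ e is encoded as a nonnegative product, that is (y - x)² ≤ e². A sign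
    -- change so close to x would give (f x)² ≤ K (y - x)² ≤ K e² < (f x)².
    no-sign-change : ∀ {x y e} → 0# < f x * f x - K F * (e * e) → 0# ≤ x → x ≤ 1# → 0# ≤ y → y ≤ 1# →
                     0# ≤ - (f x * f y) → ¬ (0# ≤ (e - (y - x)) * (e + (y - x)))
    no-sign-change {x} {y} {e} small p q r s n near = <-irrefl (<-respʳ
      (solve 4 (λ A K e d → A :- K :* (e :* e) :+ (K :* (d :* d) :- A :+ K :* ((e :- d) :* (e :+ d))) := con (+ 0))
        refl (f x * f x) (K F) e (y - x))
      (0<-+ small (0≤-+ (sign-change p q r s n) (0≤-* (0≤K F) near))))

    private
      S : Pred Carrier (c ⊔ ℓ₁ ⊔ ℓ₂)
      S y = Lift c (0# ≤ y × y ≤ 1# × f y ≤ 0#)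

    -- No monotonicity is meant, only the order of the two end values. The root is s = sup `S`. If f
    -- s > 0, no point of `S` lies within e below s, so s - e is a smaller upper bound. If f s < 0,
    -- f stays negative up to distance e above s, which either puts s + e into `S` or brings 1,
    -- where f ≥ 0, within reach.
    root-of-increasing : f 0# ≤ 0# → 0# ≤ f 1# → ∃ λ x → 0# ≤ x × f x ≈ 0#
    root-of-increasing f0≤0 0≤f1
      with supremum S (0# , lift (inj₂ refl , inj₁ 0<1 , f0≤0)) (1# , λ (lift (_ , y≤1 , _)) → y≤1)
    ... | s , ub , lub with <.compare (f s) 0#
    ...   | tri≈ _ fs≈0 _ = s , ub (lift (inj₂ refl , inj₁ 0<1 , f0≤0)) , fs≈0
    ...   | tri> _ fs≉0 0<fs = ⊥-elim (<-irrefl (<-respʳ (solve 2 (λ s e → s :- e :- s :+ e := con (+ 0)) refl s e)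
              (<-respʳ (+-comm _ _) (0<-+ 0<e (x≤y⇒0≤y-x (lub (s - e) ub′))))))
      where
      0≤s = ub (lift (inj₂ refl , inj₁ 0<1 , f0≤0))
      s≤1 = lub 1# λ (lift (_ , y≤1 , _)) → y≤1
      m = modulus (0<x² fs≉0)
      e = proj₁ m
      0<e = proj₁ (proj₂ m)
      ub′ : UpperBound S (s - e)
      ub′ {y} (lift (0≤y , y≤1 , fy≤0)) with ≤-<-connex y (s - e)
      ... | inj₁ le = le
      ... | inj₂ lt = ⊥-elim (no-sign-change (proj₂ (proj₂ m)) 0≤s s≤1 0≤y y≤1
              (≤-respʳ (solve 2 (λ a b → a :* (:- b) := :- (a :* b)) refl (f s) (f y)) (0≤-* (inj₁ 0<fs) (x≤0⇒0≤-x fy≤0)))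
              (0≤-*
                (≤-respʳ (solve 3 (λ s y e → s :- y :+ e := e :- (y :- s)) refl s y e)
                  (0≤-+ (x≤y⇒0≤y-x (ub (lift (0≤y , y≤1 , fy≤0)))) (inj₁ 0<e)))
                (≤-respʳ (solve 3 (λ s y e → y :- (s :- e) := e :+ (y :- s)) refl s y e)
                  (inj₁ (x<y⇒0<y-x lt)))))
    ...   | tri< fs<0 fs≉0 _ = ⊥-elim contra
      where
      0≤s = ub (lift (inj₂ refl , inj₁ 0<1 , f0≤0))
      s≤1 = lub 1# λ (lift (_ , y≤1 , _)) → y≤1
      m = modulus (0<x² fs≉0)
      e = proj₁ m
      0<e = proj₁ (proj₂ m)
      opposite : ∀ {y} → 0# ≤ f y → 0# ≤ - (f s * f y)
      opposite {y} p = ≤-respʳ (solve 2 (λ a b → (:- a) :* b := :- (a :* b)) refl (f s) (f y))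
        (0≤-* (inj₁ (x<0⇒0<-x fs<0)) p)
      contra : ⊥
      contra with ≤-<-connex 1# (s + e)
      -- Here s + e may leave [0,1], where nothing is known about f, so the endpoint 1 is compared
      -- with s instead.
      ... | inj₁ 1≤s+e = no-sign-change (proj₂ (proj₂ m)) 0≤s s≤1 (inj₁ 0<1) (inj₂ refl) (opposite 0≤f1)
              (0≤-*
                (≤-respʳ (solve 2 (λ s e → s :+ e :- con (+ 1) := e :- (con (+ 1) :- s)) refl s e) (x≤y⇒0≤y-x 1≤s+e))
                (0≤-+ (inj₁ 0<e) (x≤y⇒0≤y-x s≤1)))
      ... | inj₂ s+e<1 with ≤-<-connex (f (s + e)) 0#
      ...   | inj₂ 0<f = no-sign-change (proj₂ (proj₂ m)) 0≤s s≤1 (0≤-+ 0≤s (inj₁ 0<e)) (inj₁ s+e<1) (opposite (inj₁ 0<f))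
              (inj₂ (solve 2 (λ s e → con (+ 0) := (e :- (s :+ e :- s)) :* (e :+ (s :+ e :- s))) refl s e))
      ...   | inj₁ f≤0 = <-irrefl (<-respʳ (solve 2 (λ s e → e :+ (s :- (s :+ e)) := con (+ 0)) refl s e)
              (0<-+ 0<e (x≤y⇒0≤y-x (ub (lift (0≤-+ 0≤s (inj₁ 0<e) , inj₁ s+e<1 , f≤0))))))

  -- The hypothesis is a product so that callers need not know which end value is the positive one;
  -- a decreasing sign change is reduced to the increasing one by negating f.
  intermediate-value : ∀ {f} → Lipschitz f → 0# ≤ - (f 0# * f 1#) → ∃ λ x → 0# ≤ x × f x ≈ 0#
  intermediate-value {f} F h with <.compare (f 0#) 0# | <.compare (f 1#) 0#
  ... | tri≈ _ p _ | _ = 0# , inj₂ refl , p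
  ... | _ | tri≈ _ p _ = 1# , inj₁ 0<1 , p
  ... | tri< p _ _ | tri> _ _ q = root-of-increasing F (inj₁ p) (inj₁ q)
  ... | tri> _ _ p | tri< q _ _ = x , proj₁ (proj₂ r) , trans (sym (-‿involutive _)) (trans (-‿cong z) -0#≈0#)
    where
    open import Algebra.Properties.Ring ring using (-‿involutive; -0#≈0#)
    r = root-of-increasing (-‿lipschitz F)
          (0≤y-x⇒x≤y (≤-respʳ (solve 1 (λ x → x := con (+ 0) :- (:- x)) refl (f 0#)) (inj₁ p))) (x≤0⇒0≤-x (inj₁ q))
    x = proj₁ r
    z = proj₂ (proj₂ r)
  ... | tri< p _ _ | tri< q _ _ = ⊥-elim (<-irrefl (<-respʳ
          (solve 2 (λ a b → (:- a) :* (:- b) :+ (:- (a :* b)) := con (+ 0)) refl (f 0#) (f 1#))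
          (0<-+ (*-positive (x<0⇒0<-x p) (x<0⇒0<-x q)) h)))
  ... | tri> _ _ p | tri> _ _ q = ⊥-elim (<-irrefl (<-respʳ (-‿inverseʳ _) (0<-+ (*-positive p q) h)))

-- Complex numbers over the given field, and positive real roots.

module ComplexNumbers {c ℓ₁ ℓ₂} (R : CompleteOrderedField c ℓ₁ ℓ₂) where
  open CompleteOrderedField R hiding (zero)
  open OrderedField R
  open IntegerCoefficients commutativeRing using (solve; _:=_; _:+_; _:*_; _:-_; :-_; con)

  -- Built on the raw ring that defines `eval` and `monomial`, so ring lemmas and the solver apply
  -- to them without transport.
  ℂ-commutativeRing : CommutativeRing c ℓ₁
  ℂ-commutativeRing = record
    { RawRing (ℂ-rawRing R)
    ; isCommutativeRing = record
      { isRing = record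
        { +-isAbelianGroup = record
          { isGroup = record
            { isMonoid = record
              { isSemigroup = record
                { isMagma = record
                  { isEquivalence = record
                    { refl = refl , refl
                    ; sym = λ (p , q) → sym p , sym q
                    ; trans = λ (p , q) (r , s) → trans p r , trans q s
                    }
                  ; ∙-cong = λ (p , q) (r , s) → +-cong p r , +-cong q s
                  }
                ; assoc = λ _ _ _ → +-assoc _ _ _ , +-assoc _ _ _
                }
              ; identity = (λ _ → +-identityˡ _ , +-identityˡ _) , (λ _ → +-identityʳ _ , +-identityʳ _)
              }
            ; inverse = (λ _ → -‿inverseˡ _ , -‿inverseˡ _) , (λ _ → -‿inverseʳ _ , -‿inverseʳ _)
            ; ⁻¹-cong = λ (p , q) → -‿cong p , -‿cong q
            }
          ; comm = λ _ _ → +-comm _ _ , +-comm _ _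
          }
        ; *-cong = λ (p , q) (r , s) →
            +-cong (*-cong p r) (-‿cong (*-cong q s)) , +-cong (*-cong p s) (*-cong q r)
        ; *-assoc = λ (a +i b) (d +i e) (f +i g) →
            solve 6 (λ a b d e f g → (a :* d :- b :* e) :* f :- (a :* e :+ b :* d) :* g
                                  := a :* (d :* f :- e :* g) :- b :* (d :* g :+ e :* f)) refl a b d e f g ,
            solve 6 (λ a b d e f g → (a :* d :- b :* e) :* g :+ (a :* e :+ b :* d) :* f
                                  := a :* (d :* g :+ e :* f) :+ b :* (d :* f :- e :* g)) refl a b d e f g
        ; *-identity =
            (λ (a +i b) →
              solve 2 (λ a b → con (+ 1) :* a :- con (+ 0) :* b := a) refl a b ,
              solve 2 (λ a b → con (+ 1) :* b :+ con (+ 0) :* a := b) refl a b) ,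
            (λ (a +i b) →
              solve 2 (λ a b → a :* con (+ 1) :- b :* con (+ 0) := a) refl a b ,
              solve 2 (λ a b → a :* con (+ 0) :+ b :* con (+ 1) := b) refl a b)
        ; distrib =
            (λ (a +i b) (d +i e) (f +i g) →
              solve 6 (λ a b d e f g → a :* (d :+ f) :- b :* (e :+ g)
                                    := (a :* d :- b :* e) :+ (a :* f :- b :* g)) refl a b d e f g ,
              solve 6 (λ a b d e f g → a :* (e :+ g) :+ b :* (d :+ f)
                                    := (a :* e :+ b :* d) :+ (a :* g :+ b :* f)) refl a b d e f g) ,
            (λ (a +i b) (d +i e) (f +i g) →
              solve 6 (λ a b d e f g → (d :+ f) :* a :- (e :+ g) :* b
                                    := (d :* a :- e :* b) :+ (f :* a :- g :* b)) refl a b d e f g ,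
              solve 6 (λ a b d e f g → (d :+ f) :* b :+ (e :+ g) :* a
                                    := (d :* b :+ e :* a) :+ (f :* b :+ g :* a)) refl a b d e f g)
        }
      ; *-comm = λ (a +i b) (d +i e) →
          solve 4 (λ a b d e → a :* d :- b :* e := d :* a :- e :* b) refl a b d e ,
          solve 4 (λ a b d e → a :* e :+ b :* d := d :* b :+ e :* a) refl a b d e
      }
    }

  module C where
    open CommutativeRing ℂ-commutativeRing public
    open import Algebra.Properties.CommutativeSemiring.Exp
      (CommutativeRing.commutativeSemiring ℂ-commutativeRing) public
    open import Algebra.Properties.Ring (CommutativeRing.ring ℂ-commutativeRing) public

  open C using (_^_)

  _≈0? : ∀ z → Dec (z C.≈ C.0#)
  z ≈0? = (re z <.≟ 0#) ×-dec (im z <.≟ 0#)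

  real : Carrier → ℂ R
  real a = a +i 0#

  conj : ℂ R → ℂ R
  conj z = re z +i (- im z)

  norm² : ℂ R → Carrier
  norm² z = re z * re z + im z * im z

  z≉0⇒0<norm² : ∀ {z} → z C.≉ C.0# → 0# < norm² z
  z≉0⇒0<norm² {a +i b} z≉0 with a <.≟ 0#
  ... | no a≉0 = 0<-+ (0<x² a≉0) (0≤x² b)
  ... | yes a≈0 = <-respʳ (+-comm _ _) (0<-+ (0<x² λ b≈0 → z≉0 (a≈0 , b≈0)) (0≤x² a))

  z*conj : ∀ z → z C.* conj z C.≈ real (norm² z)
  z*conj (a +i b) =
    solve 2 (λ a b → a :* a :- b :* (:- b) := a :* a :+ b :* b) refl a b ,
    solve 2 (λ a b → a :* (:- b) :+ b :* a := con (+ 0)) refl a b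

  real-* : ∀ a z → real a C.* z C.≈ ((a * re z) +i (a * im z))
  real-* a (b +i d) =
    solve 3 (λ a b d → a :* b :- con (+ 0) :* d := a :* b) refl a b d ,
    solve 3 (λ a b d → a :* d :+ con (+ 0) :* b := a :* d) refl a b d

  x*y≈0⇒y≈0 : ∀ {x y} → 0# < x → x * y ≈ 0# → y ≈ 0#
  x*y≈0⇒y≈0 {x} {y} 0<x xy≈0 with 0<⇒inverse 0<x
  ... | v , _ , xv≈1 = trans (sym (*-identityˡ y)) (trans (*-congʳ (sym xv≈1))
        (trans (solve 3 (λ x v y → x :* v :* y := v :* (x :* y)) refl x v y) (trans (*-congˡ xy≈0) (zeroʳ v))))

  -- Multiplying by `conj z` turns the equation into |z|² w = 0, which is cancelled componentwise in
  -- the reals.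
  z≉0∧zw≈0⇒w≈0 : ∀ {z w} → z C.≉ C.0# → z C.* w C.≈ C.0# → w C.≈ C.0#
  z≉0∧zw≈0⇒w≈0 {z} {w} z≉0 zw≈0 = x*y≈0⇒y≈0 0<N (proj₁ Nw≈0) , x*y≈0⇒y≈0 0<N (proj₂ Nw≈0)
    where
    0<N = z≉0⇒0<norm² z≉0
    Nw≈0 : ((norm² z * re w) +i (norm² z * im w)) C.≈ C.0#
    Nw≈0 = C.trans (C.sym (real-* (norm² z) w)) (C.trans (C.*-congʳ (C.sym (z*conj z)))
      (C.trans (C.*-congʳ (C.*-comm z (conj z))) (C.trans (C.*-assoc (conj z) z w)
      (C.trans (C.*-congˡ zw≈0) (C.zeroʳ (conj z))))))

  *-≉0 : ∀ {z w} → z C.≉ C.0# → w C.≉ C.0# → z C.* w C.≉ C.0#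
  *-≉0 z≉0 w≉0 zw≈0 = w≉0 (z≉0∧zw≈0⇒w≈0 z≉0 zw≈0)

  ^-≉0 : ∀ {z} → z C.≉ C.0# → ∀ n → z ^ n C.≉ C.0#
  ^-≉0 z≉0 zero    (1≈0 , _) = 1≉0 1≈0
  ^-≉0 z≉0 (suc n) = *-≉0 z≉0 (^-≉0 z≉0 n)

  Lipschitzℂ : (Carrier → ℂ R) → Set (c ⊔ ℓ₁ ⊔ ℓ₂)
  Lipschitzℂ F = Lipschitz (λ t → re (F t)) × Lipschitz (λ t → im (F t))

  *-lipschitzℂ : ∀ {F G} → Lipschitzℂ F → Lipschitzℂ G → Lipschitzℂ (λ t → F t C.* G t)
  *-lipschitzℂ (p , q) (r , s) =
    +-lipschitz (*-lipschitz p r) (-‿lipschitz (*-lipschitz q s)) ,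
    +-lipschitz (*-lipschitz p s) (*-lipschitz q r)

  ^-lipschitzℂ : ∀ {F} → Lipschitzℂ F → ∀ n → Lipschitzℂ (λ t → F t ^ n)
  ^-lipschitzℂ L zero    = const-lipschitz 1# , const-lipschitz 0#
  ^-lipschitzℂ L (suc n) = *-lipschitzℂ L (^-lipschitzℂ L n)

  real-^ : ∀ a n → im (real a ^ n) ≈ 0#
  real-^ a zero    = refl
  real-^ a (suc n) = trans (proj₂ (real-* a (real a ^ n))) (trans (*-congˡ (real-^ a n)) (zeroʳ a))

  1≤[1+a]^n : ∀ {a} → 0# ≤ a → ∀ n → 0# ≤ re (real (1# + a) ^ n) - 1#
  1≤[1+a]^n p zero    = inj₂ (sym (-‿inverseʳ 1#))
  1≤[1+a]^n {a} p (suc n) = ≤-respʳ (trans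
      (solve 2 (λ a b → (con (+ 1) :+ a) :* (b :- con (+ 1)) :+ a := (con (+ 1) :+ a) :* b :- con (+ 1)) refl a (re (real (1# + a) ^ n)))
      (+-congʳ (sym (proj₁ (real-* (1# + a) (real (1# + a) ^ n))))))
    (0≤-+ (0≤-* (0≤-+ (inj₁ 0<1) p) (1≤[1+a]^n p n)) p)

  -- The intermediate value theorem is applied to (tB)^(n+1) - a for t in [0,1]. The bound B = 1 + a
  -- is large enough for every a > 0 because B^n ≥ 1 gives B^(n+1) ≥ B > a. Real powers are taken
  -- inside the complex numbers, so only one power operation occurs.
  root : ∀ n {a} → 0# < a → ∃ λ r → 0# < r × real r ^ suc n C.≈ real a
  root n {a} 0<a = finish (intermediate-value lip sign)
    where
    B = 1# + a
    F : Carrier → ℂ R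
    F t = real (t * B) ^ suc n
    lip : Lipschitz (λ t → re (F t) + - a)
    lip = +-lipschitz (proj₁ (^-lipschitzℂ {λ t → real (t * B)}
      (*-lipschitz id-lipschitz (const-lipschitz B) , const-lipschitz 0#) (suc n))) (const-lipschitz (- a))
    F0 : re (F 0#) ≈ 0#
    F0 = trans (proj₁ (real-* (0# * B) (real (0# * B) ^ n)))
      (trans (*-congʳ (zeroˡ B)) (zeroˡ _))
    F1 : 0# ≤ re (F 1#) - a
    F1 = ≤-respʳ (trans
        (solve 2 (λ a b → con (+ 1) :+ (con (+ 1) :+ a) :* (b :- con (+ 1)) := (con (+ 1) :+ a) :* b :- a)
          refl a (re (real B ^ n)))
        (+-congʳ (trans (sym (proj₁ (real-* B (real B ^ n)))) (proj₁ (C.^-congˡ (suc n) (sym (*-identityˡ B) , refl))))))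
      (0≤-+ (inj₁ 0<1) (0≤-* (0≤-+ (inj₁ 0<1) (inj₁ 0<a)) (1≤[1+a]^n (inj₁ 0<a) n)))
    sign : 0# ≤ - ((re (F 0#) + - a) * (re (F 1#) + - a))
    sign = ≤-respʳ (trans (solve 2 (λ a f → a :* f := :- ((con (+ 0) :- a) :* f)) refl a (re (F 1#) - a))
        (-‿cong (*-congʳ (+-congʳ (sym F0)))))
      (0≤-* (inj₁ 0<a) F1)
    finish : (∃ λ t → 0# ≤ t × re (F t) + - a ≈ 0#) → ∃ λ r → 0# < r × real r ^ suc n C.≈ real a
    finish (t , 0≤t , eq) with 0≤-* 0≤t (0≤-+ (inj₁ 0<1) (inj₁ 0<a))
    ... | inj₁ 0<r = t * B , 0<r , re-eq , real-^ (t * B) (suc n)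
      where re-eq = trans (solve 2 (λ f a → f := (f :- a) :+ a) refl (re (F t)) a) (trans (+-congʳ eq) (+-identityˡ a))
    ... | inj₂ 0≈r = contradiction (trans (solve 1 (λ a → a := :- (con (+ 0) :- a)) refl a)
          (trans (-‿cong (trans (+-congʳ (sym F≈0)) eq)) -0#≈0#)) (0<⇒≉0 0<a)
      where
      open import Algebra.Properties.Ring ring using (-0#≈0#)
      F≈0 = trans (proj₁ (real-* (t * B) (real (t * B) ^ n))) (trans (*-congʳ (sym 0≈r)) (zeroˡ _))

-- Points of the line x + i whose powers, times a given number, are real.

module UpperHalfPlaneRoots {c ℓ₁ ℓ₂} (R : CompleteOrderedField c ℓ₁ ℓ₂) where
  open CompleteOrderedField R hiding (zero)
  open OrderedField R
  open ComplexNumbers R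
  open C using (_^_)
  open IntegerCoefficients commutativeRing using (solve; _:=_; _:+_; _:*_; _:-_; :-_; con)

  0<xy⇒0<y : ∀ {x y} → 0# < x → 0# < x * y → 0# < y
  0<xy⇒0<y {x} {y} 0<x 0<xy with 0<⇒inverse 0<x
  ... | v , 0<v , xv≈1 = <-respʳ (trans (solve 3 (λ v x y → v :* (x :* y) := x :* v :* y) refl v x y)
        (trans (*-congʳ xv≈1) (*-identityˡ y))) (*-positive 0<v 0<xy)

  real-sqrt : ∀ {a} → 0# < a → ∃ λ r → r * r ≈ a
  real-sqrt 0<a = let (r , _ , rr≈a , _) = root 1 0<a in r , trans
    (solve 1 (λ r → r :* r := r :* (r :* con (+ 1) :- con (+ 0) :* con (+ 0))
                          :- con (+ 0) :* (r :* con (+ 0) :+ con (+ 0) :* con (+ 1))) refl r) rr≈a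

  -- Only the direction of the root matters for the real axis, so a positive factor is left free;
  -- one real square root, that of |z|², then suffices.
  record ScaledSqrt (z : ℂ R) : Set (c ⊔ ℓ₁ ⊔ ℓ₂) where
    field
      sqrt      : ℂ R
      scale     : Carrier
      0<scale   : 0# < scale
      isSqrt    : sqrt C.* sqrt C.≈ real scale C.* z

  -- With r = ±|z| the number r + z bisects the angle between z and the real axis.
  scaledSqrt : ∀ {z} → z C.≉ C.0# → ScaledSqrt z
  scaledSqrt {z@(a +i b)} z≉0 = choose (real-sqrt (z≉0⇒0<norm² z≉0))
    where
    N = norm² z
    double-pos : ∀ {x} → 0# < x → 0# < x + x
    double-pos p = 0<-+ p (inj₁ p)
    along : ∀ r → r * r ≈ N → r + a ≉ 0# → ScaledSqrt z
    along r rr r+a≉0 with <.compare 0# (r + a)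
    ... | tri≈ _ e _ = contradiction (sym e) r+a≉0
    ... | tri< p _ _ = record
      { sqrt = (r + a) +i b ; scale = (r + a) + (r + a) ; 0<scale = double-pos p
      ; isSqrt =
          trans (solve 3 (λ r a b → (r :+ a) :* (r :+ a) :- b :* b
              := r :* r :+ (r :* a :+ r :* a :+ a :* a :- b :* b)) refl r a b)
            (trans (+-congʳ rr) (solve 3 (λ r a b → a :* a :+ b :* b :+ (r :* a :+ r :* a :+ a :* a :- b :* b)
              := ((r :+ a) :+ (r :+ a)) :* a :- con (+ 0) :* b) refl r a b)) ,
          solve 3 (λ r a b → (r :+ a) :* b :+ b :* (r :+ a) := ((r :+ a) :+ (r :+ a)) :* b :+ con (+ 0) :* a) refl r a b
      }
    -- For r² = |z|² one has (r + z)² = 2(r + a) z. When r + a is negative, the root is i(r + z),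
    -- whose square has the opposite sign.
    ... | tri> _ _ p = record
      { sqrt = (- b) +i (r + a) ; scale = - (r + a) + - (r + a) ; 0<scale = double-pos (x<0⇒0<-x p)
      ; isSqrt =
          trans (solve 3 (λ r a b → (:- b) :* (:- b) :- (r :+ a) :* (r :+ a)
              := :- (r :* r) :+ (b :* b :- (r :* a :+ r :* a :+ a :* a))) refl r a b)
            (trans (+-congʳ (-‿cong rr)) (solve 3 (λ r a b → :- (a :* a :+ b :* b) :+ (b :* b :- (r :* a :+ r :* a :+ a :* a))
              := ((:- (r :+ a)) :+ (:- (r :+ a))) :* a :- con (+ 0) :* b) refl r a b)) ,
          solve 3 (λ r a b → (:- b) :* (r :+ a) :+ (r :+ a) :* (:- b)
              := ((:- (r :+ a)) :+ (:- (r :+ a))) :* b :+ con (+ 0) :* a) refl r a b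
      }
    choose : (∃ λ r → r * r ≈ N) → ScaledSqrt z
    choose (r , rr) with r + a <.≟ 0#
    ... | no p = along r rr p
    -- The sums r + a and -r + a cannot both vanish: their difference is 2r, while r² = |z|² > 0.
    ... | yes p = along (- r) (trans (solve 1 (λ r → (:- r) :* (:- r) := r :* r) refl r) rr) λ q →
      0<⇒≉0 (double-pos (z≉0⇒0<norm² z≉0)) (trans (+-cong (sym rr) (sym rr))
        (trans (solve 2 (λ r a → r :* r :+ r :* r := r :* ((r :+ a) :- ((:- r) :+ a))) refl r a)
        (trans (*-congˡ (trans (+-cong p (-‿cong q)) (-‿inverseʳ 0#))) (zeroʳ r))))

  upper : Carrier → ℂ R
  upper x = x +i 1#

  upper≉0 : ∀ x → upper x C.≉ C.0#
  upper≉0 x (_ , 1≈0) = 1≉0 1≈0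

  ray : ℂ R → ℕ → Carrier → ℂ R
  ray z d x = z C.* upper x ^ d

  RealPoint : ℕ → Set (c ⊔ ℓ₁)
  RealPoint d = ∀ z → ∃ λ x → im (ray z d x) ≈ 0#

  PositivePoint : ℕ → Set (c ⊔ ℓ₁ ⊔ ℓ₂)
  PositivePoint d = ∀ {z} → z C.≉ C.0# → ∃ λ x → 0# < re (ray z d x) × im (ray z d x) ≈ 0#

  ray-cong : ∀ z d {x y} → x ≈ y → ray z d x C.≈ ray z d y
  ray-cong z d p = C.*-congˡ {z} (C.^-congˡ d (p , refl))

  -- The segment is parametrised by t in [0,1], so x and y may come in either order.
  real-between : ∀ z d x y → 0# ≤ - (im (ray z d x) * im (ray z d y)) → ∃ λ t → im (ray z d t) ≈ 0#
  real-between z d x y sign = line (proj₁ found) , proj₂ (proj₂ found)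
    where
    line : Carrier → Carrier
    line t = x + t * (y - x)
    lip : Lipschitz (λ t → im (ray z d (line t)))
    lip = proj₂ (*-lipschitzℂ {λ _ → z} {λ t → upper (line t) ^ d} (const-lipschitz (re z) , const-lipschitz (im z))
      (^-lipschitzℂ {λ t → upper (line t)}
        (+-lipschitz (const-lipschitz x) (*-lipschitz id-lipschitz (const-lipschitz (y - x))) , const-lipschitz 1#) d))
    line0 : x ≈ line 0#
    line0 = solve 2 (λ x y → x := x :+ con (+ 0) :* (y :- x)) refl x y
    line1 : y ≈ line 1#
    line1 = solve 2 (λ x y → y := x :+ con (+ 1) :* (y :- x)) refl x y
    found = intermediate-value lip (≤-respʳ
      (-‿cong (*-cong (proj₂ (ray-cong z d line0)) (proj₂ (ray-cong z d line1)))) sign)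

  module _ {n : ℕ} where
    open IntegerCoefficients commutativeRing using () renaming (Polynomial to Expr)

    -- Real and imaginary part of (x + i)^d as solver expressions. The recursion copies `_^_` and
    -- complex multiplication literally, factors 1 included, so that its meaning agrees with `ray`
    -- by reduction.
    :upper-^ : ℕ → Expr n → Expr n × Expr n
    :upper-^ zero    x = con (+ 1) , con (+ 0)
    :upper-^ (suc d) x = let (p , q) = :upper-^ d x in x :* p :- con (+ 1) :* q , x :* q :+ con (+ 1) :* p

    :im-ray : ℕ → Expr n → Expr n → Expr n → Expr n
    :im-ray d a b x = let (p , q) = :upper-^ d x in a :* q :+ b :* p

  -- Since (1 + i)² = 2i and (-1 + i)² = -2i, the imaginary parts at 1 and -1 are 2a and -2a.
  realPoint₂ : RealPoint 2
  realPoint₂ z@(a +i b) = real-between z 2 1# (- 1#) (≤-respʳ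
    (solve 2 (λ a b → (a :+ a) :* (a :+ a) := :- (:im-ray 2 a b (con (+ 1)) :* :im-ray 2 a b (:- con (+ 1)))) refl a b)
    (0≤x² (a + a)))

  -- The cubes of i, -1 + i and 1 + i are -i, 2 + 2i and -2 + 2i, so the imaginary parts at 0, -1
  -- and 1 are -a, 2(a + b) and 2(a - b). The sign of ab tells which of -1 and 1 to pair with 0.
  realPoint₃ : RealPoint 3
  realPoint₃ z@(a +i b) with ≤-<-connex 0# (a * b)
  ... | inj₁ 0≤ab = real-between z 3 0# (- 1#) (≤-respʳ
    (solve 2 (λ a b → (a :* a :+ a :* b) :+ (a :* a :+ a :* b) := :- (:im-ray 3 a b (con (+ 0)) :* :im-ray 3 a b (:- con (+ 1)))) refl a b)
    (0≤-+ (0≤-+ (0≤x² a) 0≤ab) (0≤-+ (0≤x² a) 0≤ab)))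
  ... | inj₂ ab<0 = real-between z 3 0# 1# (≤-respʳ
    (solve 2 (λ a b → (a :* a :- a :* b) :+ (a :* a :- a :* b) := :- (:im-ray 3 a b (con (+ 0)) :* :im-ray 3 a b (con (+ 1)))) refl a b)
    (0≤-+ (0≤-+ (0≤x² a) ab′) (0≤-+ (0≤x² a) ab′)))
    where ab′ = inj₁ (x<0⇒0<-x ab<0)

  ray-≉0 : ∀ {z} → z C.≉ C.0# → ∀ d x → ray z d x C.≉ C.0#
  ray-≉0 z≉0 d x = *-≉0 z≉0 (^-≉0 (upper≉0 x) d)

  -- If s is a scaled square root of z and w = s (x + i)^m is real, then w² is a positive multiple
  -- of z (x + i)^(2m). As the square of a nonzero real it is positive: doubling upgrades a real
  -- value to a positive one.
  positivePoint-double : ∀ m → RealPoint m → PositivePoint (m ℕ.+ m)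
  positivePoint-double m P {z} z≉0 = x ,
    0<xy⇒0<y 0<scale (<-respʳ re-eq (0<x² re≉0)) ,
    x*y≈0⇒y≈0 0<scale im-eq
    where
    open ScaledSqrt (scaledSqrt z≉0)
    x = proj₁ (P sqrt)
    w = ray sqrt m x
    im-w : im w ≈ 0#
    im-w = proj₂ (P sqrt)
    sqrt≉0 : sqrt C.≉ C.0#
    sqrt≉0 s≈0 = *-≉0 (λ (p , _) → 0<⇒≉0 0<scale p) z≉0
      (C.trans (C.sym isSqrt) (C.trans (C.*-congʳ s≈0) (C.zeroˡ sqrt)))
    re≉0 : re w ≉ 0#
    re≉0 p = ray-≉0 sqrt≉0 m x (p , im-w)
    w² : w C.* w C.≈ real scale C.* ray z (m ℕ.+ m) x
    w² = C.trans (solveℂ 2 (λ s u → (s ×ℂ u) ×ℂ (s ×ℂ u) =ℂ (s ×ℂ s) ×ℂ (u ×ℂ u)) C.refl sqrt (upper x ^ m))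
      (C.trans (C.*-cong isSqrt (C.sym (C.^-homo-* (upper x) m m))) (C.*-assoc _ _ _))
      where open IntegerCoefficients ℂ-commutativeRing using () renaming (solve to solveℂ; _:=_ to _=ℂ_; _:*_ to _×ℂ_)
    w²-real : real scale C.* ray z (m ℕ.+ m) x C.≈ ((scale * re (ray z (m ℕ.+ m) x)) +i (scale * im (ray z (m ℕ.+ m) x)))
    w²-real = real-* scale (ray z (m ℕ.+ m) x)
    re-eq : re w * re w ≈ scale * re (ray z (m ℕ.+ m) x)
    re-eq = trans (solve 1 (λ a → a :* a := a :* a :- con (+ 0) :* con (+ 0)) refl (re w))
      (trans (+-congˡ (-‿cong (*-cong (sym im-w) (sym im-w)))) (trans (proj₁ w²) (proj₁ w²-real)))
    im-eq : scale * im (ray z (m ℕ.+ m) x) ≈ 0#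
    im-eq = trans (sym (trans (proj₂ w²) (proj₂ w²-real)))
      (trans (+-cong (*-congˡ im-w) (*-congʳ im-w)) (solve 1 (λ a → a :* con (+ 0) :+ con (+ 0) :* a := con (+ 0)) refl (re w)))

  im-step : ∀ z d x → im (ray z (suc d) x) ≈ re (ray z d x) + im (ray z d x) * x
  im-step z d x = trans
    (proj₂ (C.trans (C.*-congˡ (C.*-comm (upper x) (upper x ^ d))) (C.sym (C.*-assoc z (upper x ^ d) (upper x)))))
    (+-congʳ (*-identityʳ _))

  realPoint-0 : ∀ {z} → z C.≈ C.0# → ∀ d x → im (ray z d x) ≈ 0#
  realPoint-0 z≈0 d x = proj₂ (C.trans (C.*-congʳ z≈0) (C.zeroˡ (upper x ^ d)))

  realPoint-positive : ∀ d → PositivePoint d → RealPoint d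
  realPoint-positive d Q z with z ≈0?
  ... | yes z≈0 = 0# , realPoint-0 z≈0 d 0#
  ... | no z≉0 = proj₁ (Q z≉0) , proj₂ (proj₂ (Q z≉0))

  -- The imaginary part in degree d + 1 is positive (negative) at a point where
  -- the value in degree d lies on the positive (negative) real axis.
  realPoint-suc : ∀ d → PositivePoint d → RealPoint (suc d)
  realPoint-suc d Q z with z ≈0?
  ... | yes z≈0 = 0# , realPoint-0 z≈0 (suc d) 0#
  ... | no z≉0 = real-between z (suc d) x y (≤-respʳ
      (trans (solve 2 (λ a b → a :* b := :- (a :* (:- b))) refl (re (ray z d x)) (re (ray (C.- z) d y)))
        (-‿cong (*-cong (sym at-x) (sym at-y))))
      (inj₁ (*-positive 0<x 0<y)))
    where
    -z≉0 : C.- z C.≉ C.0#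
    -z≉0 p = z≉0 (C.trans (C.sym (C.-‿involutive z)) (C.trans (C.-‿cong p) C.-0#≈0#))
    x = proj₁ (Q z≉0)
    0<x = proj₁ (proj₂ (Q z≉0))
    y = proj₁ (Q -z≉0)
    0<y = proj₁ (proj₂ (Q -z≉0))
    vanish : ∀ {a b} x → b ≈ 0# → a + b * x ≈ a
    vanish {a} x p = trans (+-congˡ (trans (*-congʳ p) (zeroˡ x))) (+-identityʳ a)
    at-x : im (ray z (suc d) x) ≈ re (ray z d x)
    at-x = trans (im-step z d x) (vanish x (proj₂ (proj₂ (Q z≉0))))
    neg : ray z (suc d) y C.≈ C.- ray (C.- z) (suc d) y
    neg = C.trans (C.sym (C.-‿involutive _)) (C.-‿cong (C.-‿distribˡ-* z (upper y ^ suc d)))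
    at-y : im (ray z (suc d) y) ≈ - re (ray (C.- z) d y)
    at-y = trans (proj₂ neg) (-‿cong (trans (im-step (C.- z) d y) (vanish y (proj₂ (proj₂ (Q -z≉0))))))

  data Halves : ℕ → Set where
    even : ∀ m → Halves (m ℕ.+ m)
    odd  : ∀ m → Halves (suc (m ℕ.+ m))

  halves : ∀ n → Halves n
  halves zero = even 0
  halves (suc n) with halves n
  ... | even m = odd m
  ... | odd m = ≡.subst Halves (≡.cong suc (ℕ.+-suc m m)) (even (suc m))

  -- The bound 2 ≤ d is carried through the recursion because degrees 0 and 1 fail, for instance at
  -- z = i and z = 1; halving 2 or 3 would land there.
  realPoint : ∀ d → 2 ℕ.≤ d → RealPoint d
  realPoint = <-rec _ step
    where
    step : ∀ d → (∀ {m} → m ℕ.< d → 2 ℕ.≤ m → RealPoint m) → 2 ℕ.≤ d → RealPoint d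
    step d rec 2≤d with halves d | 2≤d
    ... | even 0 | ()
    ... | odd 0  | s≤s ()
    ... | even 1 | _ = realPoint₂
    ... | odd 1  | _ = realPoint₃
    ... | even m@(suc (suc _)) | _ = realPoint-positive (m ℕ.+ m)
          (positivePoint-double m (rec (ℕ.m<m+n m (s≤s z≤n)) (s≤s (s≤s z≤n))))
    ... | odd m@(suc (suc _)) | _ = realPoint-suc (m ℕ.+ m)
          (positivePoint-double m (rec (s≤s (ℕ.m≤m+n m m)) (s≤s (s≤s z≤n))))

-- Folds over the upper triangle in a commutative monoid.

module UpperFold {a ℓ} (M : CommutativeMonoid a ℓ) where
  open CommutativeMonoid M
  open import Algebra.Properties.CommutativeMonoid.Sum M

  sum-ε : ∀ {n} {t : Fin n → Carrier} → (∀ i → t i ≈ ε) → sum t ≈ ε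
  sum-ε {n} t≈ε = trans (sum-cong-≋ t≈ε) (sum-replicate-zero n)

  sum-single : ∀ {n} (i : Fin n) {t : Fin n → Carrier} → (∀ k → k ≢ i → t k ≈ ε) → sum t ≈ t i
  sum-single {suc n} i {t} t≈ε = trans (sum-remove {i = i} t)
    (trans (∙-congˡ (sum-ε λ k → t≈ε _ (Fin.punchInᵢ≢i i k))) (identityʳ (t i)))

  upperFold-cong : ∀ {n} (X Y : Matrix Carrier n) → (∀ i j → i ≤ᶠ j → X i j ≈ Y i j) →
                   upperFold rawMonoid X ≈ upperFold rawMonoid Y
  upperFold-cong {n} X Y X≈Y = sum-cong-≋ {n} λ i → sum-cong-≋ {n} λ j → entry i j (i Fin.≤? j)
    where
    entry : ∀ i j (i≤?j : Dec (i ≤ᶠ j)) → (if does i≤?j then X i j else ε) ≈ (if does i≤?j then Y i j else ε)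
    entry i j (yes i≤j) = X≈Y i j i≤j
    entry i j (no _)    = refl

  upperFold-∙ : ∀ {n} (X Y : Matrix Carrier n) →
    upperFold rawMonoid (λ i j → X i j ∙ Y i j) ≈ upperFold rawMonoid X ∙ upperFold rawMonoid Y
  upperFold-∙ {n} X Y = trans
    (sum-cong-≋ {n} λ i → trans (sum-cong-≋ {n} λ j → if-∙ (does (i Fin.≤? j))) (∑-distrib-+ {n} (upper X i) (upper Y i)))
    (∑-distrib-+ {n} (sum ∘ upper X) (sum ∘ upper Y))
    where
    upper : Matrix Carrier n → Matrix Carrier n
    upper X i j = if does (i Fin.≤? j) then X i j else ε
    if-∙ : ∀ b {x y} → (if b then x ∙ y else ε) ≈ (if b then x else ε) ∙ (if b then y else ε)
    if-∙ true  = refl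
    if-∙ false = sym (identityˡ ε)

  upperFold-single : ∀ {n} (X : Matrix Carrier n) {i j} → i ≤ᶠ j → (∀ k l → k ≢ i ⊎ l ≢ j → X k l ≈ ε) →
                     upperFold rawMonoid X ≈ X i j
  upperFold-single {n} X {i} {j} i≤j X≈ε = trans
    (sum-single {n} i λ k k≢i → sum-ε {n} λ l → outside k l (k Fin.≤? l) (inj₁ k≢i))
    (trans (sum-single {n} j λ l l≢j → outside i l (i Fin.≤? l) (inj₂ l≢j)) (at-ij (i Fin.≤? j)))
    where
    outside : ∀ k l (k≤?l : Dec (k ≤ᶠ l)) → k ≢ i ⊎ l ≢ j → (if does k≤?l then X k l else ε) ≈ ε
    outside k l (yes _) p = X≈ε k l p
    outside k l (no _)  p = refl
    at-ij : (i≤?j : Dec (i ≤ᶠ j)) → (if does i≤?j then X i j else ε) ≈ X i j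
    at-ij (yes _)  = refl
    at-ij (no i≰j) = contradiction i≤j i≰j

-- Monomials as multiplicative functions, and their independence.

module Monomials {c ℓ₁ ℓ₂} (R : CompleteOrderedField c ℓ₁ ℓ₂) where
  open CompleteOrderedField R hiding (zero)
  open OrderedField R
  open ComplexNumbers R
  open C using (_^_)
  open UpperFold C.*-commutativeMonoid

  1^n≈1 : ∀ n → C.1# ^ n C.≈ C.1#
  1^n≈1 zero    = C.refl
  1^n≈1 (suc n) = C.trans (C.*-identityˡ _) (1^n≈1 n)

  0^n≈0 : ∀ {n} → n ℕ.≥ 1 → C.0# ^ n C.≈ C.0#
  0^n≈0 {suc n} _ = C.zeroˡ (C.0# ^ n)

  ^-upperFold : ∀ {n} τ (e : Matrix ℕ n) →
    τ ^ upperFold ℕ.+-0-rawMonoid e C.≈ upperFold C.*-rawMonoid (λ i j → τ ^ e i j)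
  ^-upperFold {n} τ e = C.trans (^-sum (λ i → ℕsum λ j → if does (i Fin.≤? j) then e i j else 0))
    (sum-cong-≋ {n} λ i → C.trans (^-sum (λ j → if does (i Fin.≤? j) then e i j else 0))
      (sum-cong-≋ {n} λ j → ^-if (does (i Fin.≤? j)) (e i j)))
    where
    open import Algebra.Properties.CommutativeMonoid.Sum C.*-commutativeMonoid using (sum; sum-cong-≋)
    open import Algebra.Definitions.RawMonoid ℕ.+-0-rawMonoid using () renaming (sum to ℕsum)
    ^-sum : ∀ {m} (t : Fin m → ℕ) → τ ^ ℕsum t C.≈ sum (λ i → τ ^ t i)
    ^-sum {zero}  t = C.refl
    ^-sum {suc m} t = C.trans (C.^-homo-* τ (t Fin.zero) _) (C.*-congˡ (^-sum (t ∘ Fin.suc)))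
    ^-if : ∀ b k → τ ^ (if b then k else 0) C.≈ (if b then τ ^ k else C.1#)
    ^-if true  k = C.refl
    ^-if false k = C.refl

  -- An entry whose variable does not occur in the monomial is left unconstrained; this lets one
  -- lemma serve diagonal and off-diagonal monomials.
  monomial-scale : ∀ {n} (α : Exponent n) τ {M N : Matrix (ℂ R) n} →
    (∀ i j → exponent α i j ≡ 0 ⊎ M i j C.≈ τ C.* N i j) →
    monomial R α M C.≈ τ ^ degree α C.* monomial R α N
  monomial-scale α τ {M} {N} scaled = C.trans (upperFold-cong _ _ λ i j _ → entry i j)
    (C.trans (upperFold-∙ (λ i j → τ ^ exponent α i j) (λ i j → N i j ^ exponent α i j)) (C.*-congʳ (C.sym (^-upperFold τ (exponent α)))))
    where
    entry : ∀ i j → M i j ^ exponent α i j C.≈ τ ^ exponent α i j C.* N i j ^ exponent α i j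
    entry i j with scaled i j
    ... | inj₁ e≡0 rewrite e≡0 = C.sym (C.*-identityˡ C.1#)
    ... | inj₂ M≈τN = C.trans (C.^-congˡ (exponent α i j) M≈τN) (C.^-distrib-* τ (N i j) (exponent α i j))

  -- This is scaling with τ = 0: each relevant entry equals 0 times itself, and 0 to a positive
  -- degree is 0.
  monomial-0 : ∀ {n} (α : Exponent n) {M : Matrix (ℂ R) n} → degree α ℕ.≥ 1 →
    (∀ i j → exponent α i j ≡ 0 ⊎ M i j C.≈ C.0#) → monomial R α M C.≈ C.0#
  monomial-0 α {M} d≥1 vanishes = C.trans
    (monomial-scale α C.0# {M} {M} λ i j → [ inj₁ , (λ M≈0 → inj₂ (C.trans M≈0 (C.sym (C.zeroˡ (M i j))))) ]′ (vanishes i j))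
    (C.trans (C.*-congʳ (0^n≈0 d≥1)) (C.zeroˡ _))

  monomial-* : ∀ {n} (α : Exponent n) {L M N : Matrix (ℂ R) n} →
    (∀ i j → i ≤ᶠ j → L i j C.≈ M i j C.* N i j) →
    monomial R α L C.≈ monomial R α M C.* monomial R α N
  monomial-* α {L} {M} {N} L≈MN = C.trans
    (upperFold-cong _ _ λ i j i≤j → C.trans (C.^-congˡ (exponent α i j) (L≈MN i j i≤j)) (C.^-distrib-* (M i j) (N i j) (exponent α i j)))
    (upperFold-∙ (λ i j → M i j ^ exponent α i j) (λ i j → N i j ^ exponent α i j))

  -- A homomorphism from real matrices under entrywise multiplication to the complex numbers. The
  -- argument may be any matrix, since only entries on or above the diagonal are read.
  character : ∀ {n} → Exponent n → Matrix Carrier n → ℂ R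
  character α u = monomial R α (λ i j → real (u i j))

  character-* : ∀ {n} (α : Exponent n) u v →
    character α (λ i j → u i j * v i j) C.≈ character α u C.* character α v
  character-* α u v = monomial-* α λ i j _ → C.sym (C.trans (real-* (u i j) (real (v i j))) (refl , zeroʳ (u i j)))

  character-1 : ∀ {n} (α : Exponent n) → character α (λ _ _ → 1#) C.≈ C.1#
  character-1 {n} α = C.trans (upperFold-cong (λ i j → C.1# ^ exponent α i j) (λ _ _ → C.1#) λ i j _ → 1^n≈1 (exponent α i j)) upperFold-ε
    where
    upperFold-ε : upperFold C.*-rawMonoid {n} (λ _ _ → C.1#) C.≈ C.1#
    upperFold-ε = sum-ε {n} λ i → sum-ε {n} λ j → if-same (does (i Fin.≤? j))
      where
      if-same : ∀ b → (if b then C.1# else C.1#) C.≈ C.1#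
      if-same true  = C.refl
      if-same false = C.refl

  2# = 1# + 1#

  0<2^n : ∀ n → 0# < re (real 2# ^ n)
  0<2^n zero    = 0<1
  0<2^n (suc n) = <-respʳ (sym (proj₁ (real-* 2# (real 2# ^ n)))) (*-positive (0<-+ 0<1 (inj₁ 0<1)) (0<2^n n))

  2^n<2^[1+n] : ∀ n → re (real 2# ^ n) < re (real 2# ^ suc n)
  2^n<2^[1+n] n = 0<y-x⇒x<y (<-respʳ
    (trans (solve 1 (λ p → p := (con (+ 1) :+ con (+ 1)) :* p :- p) refl _)
      (+-congʳ (sym (proj₁ (real-* 2# (real 2# ^ n))))))
    (0<2^n n))
    where open IntegerCoefficients commutativeRing using (solve; _:=_; _:+_; _:*_; _:-_; con)

  2^-mono : ∀ {m n} → m ℕ.<′ n → re (real 2# ^ m) < re (real 2# ^ n)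
  2^-mono {m} ℕ.<′-base = 2^n<2^[1+n] m
  2^-mono (ℕ.≤′-step {n} p) = <.trans (2^-mono p) (2^n<2^[1+n] n)

  2^-injective : ∀ m n → real 2# ^ m C.≈ real 2# ^ n → m ≡ n
  2^-injective m n (eq , _) with ℕ.<-cmp m n
  ... | tri< m<n _ _ = contradiction (<.<-respˡ-≈ eq (2^-mono (ℕ.<⇒<′ m<n))) <-irrefl
  ... | tri≈ _ m≡n _ = m≡n
  ... | tri> _ _ n<m = contradiction (<-respʳ eq (2^-mono (ℕ.<⇒<′ n<m))) <-irrefl

  -- The test matrix has a 2 at one position where the exponents differ and 1 elsewhere, so each
  -- character takes a power of 2 there, and powers of 2 determine their exponent. Symmetry of the
  -- exponents moves the position into the upper triangle.
  character-separates : ∀ {n} {α β : Exponent n} → ¬ α ≐ β → ∃ λ v → character β v C.- character α v C.≉ C.0#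
  character-separates {n} {α} {β} α≠β with Fin.¬∀⟶∃¬ n _ (λ i → Fin.all? λ j → exponent α i j ℕ.≟ exponent β i j) α≠β
  ... | i , p with Fin.¬∀⟶∃¬ n _ (λ j → exponent α i j ℕ.≟ exponent β i j) p
  ...   | j , αij≢βij = [ at i j αij≢βij , at j i (λ e → αij≢βij
            (≡.trans (symmetric α i j) (≡.trans e (symmetric β j i)))) ]′ (Fin.≤-total i j)
    where
    at : ∀ i j → exponent α i j ≢ exponent β i j → i ≤ᶠ j → ∃ λ v → character β v C.- character α v C.≉ C.0#
    at i j αij≢βij i≤j = v , λ eq → αij≢βij (2^-injective _ _
        (C.trans (C.sym (value α)) (C.trans (C.sym (C.x∙y⁻¹≈ε⇒x≈y _ _ eq)) (value β))))
      where
      v : Matrix Carrier n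
      v k l = if does ((k Fin.≟ i) ×-dec (l Fin.≟ j)) then 2# else 1#
      v-ij : v i j ≈ 2#
      v-ij with i Fin.≟ i | j Fin.≟ j
      ... | yes _ | yes _ = refl
      ... | no p  | _     = contradiction ≡.refl p
      ... | yes _ | no p  = contradiction ≡.refl p
      v-out : ∀ k l → k ≢ i ⊎ l ≢ j → v k l ≈ 1#
      v-out k l p with k Fin.≟ i | l Fin.≟ j
      ... | no _  | _     = refl
      ... | yes _ | no _  = refl
      v-out k l (inj₁ k≢i) | yes k≡i | yes _ = contradiction k≡i k≢i
      v-out k l (inj₂ l≢j) | yes _ | yes l≡j = contradiction l≡j l≢j
      value : ∀ γ → character γ v C.≈ real 2# ^ exponent γ i j
      value γ = C.trans
        (upperFold-single (λ k l → real (v k l) ^ exponent γ k l) i≤j λ k l p → C.trans (C.^-congˡ (exponent γ k l) (v-out k l p , refl)) (1^n≈1 (exponent γ k l)))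
        (C.^-congˡ (exponent γ i j) (v-ij , refl))

  Terms : ℕ → Set c
  Terms n = List (ℂ R × Exponent n)

  -- The weight `g` absorbs the factors that Dedekind's induction puts on the coefficients, so the
  -- list of terms and its distinctness proof stay untouched.
  weightedSum : ∀ {n} → Terms n → (Exponent n → ℂ R) → Matrix Carrier n → ℂ R
  weightedSum ts g u = foldr (λ (a , α) s → a C.* g α C.* character α u C.+ s) C.0# ts

  weightedSum-0 : ∀ {n} (ts : Terms n) g u → (∀ {a α} → (a , α) ∈ ts → a C.* g α C.≈ C.0#) →
                  weightedSum ts g u C.≈ C.0#
  weightedSum-0 [] g u _ = C.refl
  weightedSum-0 ((a , α) ∷ ts) g u zeros = C.trans
    (C.+-cong (C.trans (C.*-congʳ (zeros (here ≡.refl))) (C.zeroˡ (character α u))) (weightedSum-0 ts g u (zeros ∘ there)))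
    (C.+-identityˡ C.0#)

  weightedSum-twist : ∀ {n} (ts : Terms n) g k u v →
    weightedSum ts (λ β → g β C.* (character β v C.- k)) u C.≈
    weightedSum ts g (λ i j → u i j * v i j) C.- k C.* weightedSum ts g u
  weightedSum-twist [] g k u v = C.sym (C.trans (C.+-congˡ (C.-‿cong (C.zeroʳ k))) (C.-‿inverseʳ C.0#))
  weightedSum-twist ((b , β) ∷ ts) g k u v = C.trans
    (C.+-congˡ (weightedSum-twist ts g k u v))
    (C.trans
      (solve 7 (λ b g χu χv k s t → b :* (g :* (χv :- k)) :* χu :+ (s :- k :* t)
                  := (b :* g :* (χu :* χv) :+ s) :- k :* (b :* g :* χu :+ t)) C.refl
        b (g β) (character β u) (character β v) k (weightedSum ts g (λ i j → u i j * v i j)) (weightedSum ts g u))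
      (C.+-congʳ (C.+-congʳ (C.*-congˡ (C.sym (character-* β u v))))))
    where open IntegerCoefficients ℂ-commutativeRing using (solve; _:=_; _:+_; _:*_; _:-_)

  -- Dedekind's argument: twisting by v and subtracting the multiple by
  -- character α v removes the leading term, and v is chosen to keep any other.
  characters-independent : ∀ {n} (ts : Terms n) → AllPairs (λ α β → ¬ α ≐ β) (map proj₂ ts) →
    ∀ g → (∀ u → weightedSum ts g u C.≈ C.0#) → ∀ {b β} → (b , β) ∈ ts → b C.* g β C.≈ C.0#
  characters-independent ((a , α) ∷ ts) (α≠ts ∷ distinct-ts) g vanishes = λ where
      (here ≡.refl) → head
      (there b∈ts)  → tail b∈ts
    where
    open IntegerCoefficients ℂ-commutativeRing using (solve; _:=_; _:+_; _:*_; _:-_; con)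
    twisted : ∀ v u → weightedSum ts (λ β → g β C.* (character β v C.- character α v)) u C.≈ C.0#
    twisted v u = C.trans (weightedSum-twist ts g (character α v) u v)
      (C.trans (solve 5 (λ ag χu χv s t → s :- χv :* t := (ag :* (χu :* χv) :+ s) :- χv :* (ag :* χu :+ t)) C.refl
        (a C.* g α) (character α u) (character α v) (weightedSum ts g (λ i j → u i j * v i j)) (weightedSum ts g u))
      (C.trans (C.+-cong
          (C.trans (C.+-congʳ (C.*-congˡ (C.sym (character-* α u v)))) (vanishes (λ i j → u i j * v i j)))
          (C.-‿cong (C.*-congˡ (vanishes u))))
        (solve 1 (λ χv → con (+ 0) :- χv :* con (+ 0) := con (+ 0)) C.refl (character α v))))
    distinct-from : ∀ {ts : Terms _} → All (λ β → ¬ α ≐ β) (map proj₂ ts) → ∀ {b β} → (b , β) ∈ ts → ¬ α ≐ β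
    distinct-from {_ ∷ _} (p ∷ _)  (here ≡.refl) = p
    distinct-from {_ ∷ _} (_ ∷ ps) (there b∈ts)  = distinct-from ps b∈ts
    tail : ∀ {b β} → (b , β) ∈ ts → b C.* g β C.≈ C.0#
    tail {b} {β} b∈ts = let (v , δ≉0) = character-separates {α = α} {β} (distinct-from α≠ts b∈ts) in
      z≉0∧zw≈0⇒w≈0 δ≉0 (C.trans
        (solve 3 (λ δ b g → δ :* (b :* g) := b :* (g :* δ)) C.refl (character β v C.- character α v) b (g β))
        (characters-independent ts distinct-ts (λ β → g β C.* (character β v C.- character α v)) (twisted v) b∈ts))
    head : a C.* g α C.≈ C.0#
    -- At the all-ones matrix every character is 1 and the tail is already known to vanish, so the
    -- relation reduces to the leading coefficient.
    head = C.trans (C.sym (C.*-identityʳ _)) (C.trans (C.*-congˡ (C.sym (character-1 α)))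
      (C.trans (C.sym (C.+-identityʳ _)) (C.trans (C.+-congˡ (C.sym (weightedSum-0 ts g (λ _ _ → 1#) tail)))
        (vanishes (λ _ _ → 1#)))))

-- Solving τᵈ F + sᵈ G = 0 with τ in the upper half-plane.

module UpperZeros {c ℓ₁ ℓ₂} (R : CompleteOrderedField c ℓ₁ ℓ₂) where
  open CompleteOrderedField R hiding (zero)
  open OrderedField R
  open ComplexNumbers R
  open UpperHalfPlaneRoots R
  open Monomials R
  open C using (_^_)
  open IntegerCoefficients ℂ-commutativeRing using (solve; _:=_; _:+_; _:*_; _:-_; :-_; con)

  record UpperZero (d : ℕ) (F G : ℂ R) : Set (c ⊔ ℓ₁ ⊔ ℓ₂) where
    constructor upperZero
    field
      τ      : ℂ R
      0<im   : 0# < im τ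
      isZero : τ ^ d C.* F C.+ G C.≈ C.0#

  -- A positive multiple of -F/G, for nonzero G, written without division: (x + i)^d has the
  -- direction of -G/F exactly when its product with this number is positive.
  target : ℂ R → ℂ R → ℂ R
  target F G = C.- (F C.* conj G)

  conj≉0 : ∀ {z} → z C.≉ C.0# → conj z C.≉ C.0#
  conj≉0 {a +i b} z≉0 (a≈0 , -b≈0) = z≉0 (a≈0 , trans (sym (R′.-‿involutive b)) (trans (-‿cong -b≈0) R′.-0#≈0#))
    where
    import Algebra.Properties.Ring ring as R′

  -- For real r the equation (r (x + i))ᵈ F + G = 0, multiplied by the conjugate
  -- of G, reads rᵈ ρ = |G|², where ρ is the value of the ray at x.
  rescale : ∀ d {F G z} → G C.≉ C.0# → z C.≈ target F G → ∀ x →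
            0# < re (ray z (suc d) x) → im (ray z (suc d) x) ≈ 0# → UpperZero (suc d) F G
  rescale d {F} {G} {z} G≉0 z≈target x 0<ρ im≈0 with 0<⇒inverse 0<ρ
  ... | v , 0<v , ρv≈1 = scaled (root d (*-positive (z≉0⇒0<norm² G≉0) 0<v))
    where
    D = suc d
    N = norm² G
    ρ = re (ray z D x)
    scaled : (∃ λ r → 0# < r × real r ^ D C.≈ real (N * v)) → UpperZero D F G
    scaled (r , 0<r , r^D≈Nv) = upperZero (real r C.* upper x)
      (<-respʳ (sym (trans (proj₂ (real-* r (upper x))) (*-identityʳ r))) 0<r)
      (z≉0∧zw≈0⇒w≈0 (conj≉0 G≉0) (begin
        conj G C.* ((real r C.* upper x) ^ D C.* F C.+ G)
          ≈⟨ C.*-congˡ (C.+-congʳ (C.*-congʳ (C.^-distrib-* (real r) (upper x) D))) ⟩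
        conj G C.* (real r ^ D C.* upper x ^ D C.* F C.+ G)
          ≈⟨ solve 5 (λ G F rD uD cG → cG :* (rD :* uD :* F :+ G) := G :* cG :- rD :* (:- (F :* cG) :* uD)) C.refl
               G F (real r ^ D) (upper x ^ D) (conj G) ⟩
        G C.* conj G C.- real r ^ D C.* ray (target F G) D x
          ≈⟨ C.+-cong (z*conj G) (C.-‿cong (C.*-cong r^D≈Nv
               (C.trans (C.*-congʳ (C.sym z≈target)) (refl , im≈0)))) ⟩
        real N C.- real (N * v) C.* real ρ
          ≈⟨ C.+-congˡ (C.-‿cong (C.trans (real-* (N * v) (real ρ)) (cancel , zeroʳ (N * v)))) ⟩
        real N C.- real N
          ≈⟨ C.-‿inverseʳ (real N) ⟩
        C.0# ∎))
      where
      open import Relation.Binary.Reasoning.Setoid C.setoid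
      cancel : N * v * ρ ≈ N
      cancel = trans (*-assoc N v ρ) (trans (*-congˡ (trans (*-comm v ρ) ρv≈1)) (*-identityʳ N))

  ^-double-neg : ∀ m → (C.- C.1#) ^ (m ℕ.+ m) C.≈ C.1#
  ^-double-neg m = C.trans (C.^-homo-* (C.- C.1#) m m) (C.trans (C.sym (C.^-distrib-* (C.- C.1#) (C.- C.1#) m))
    (C.trans (C.^-congˡ m (solve 0 (:- con (+ 1) :* (:- con (+ 1)) := con (+ 1)) C.refl)) (1^n≈1 m)))

  target-cong : ∀ {F G H} → G C.≈ H → target F G C.≈ target F H
  target-cong (p , q) = C.-‿cong (C.*-congˡ (p , -‿cong q))

  -- The sign is only needed in odd degree, where realPoint does not control
  -- the half of the real axis that is hit.
  signedUpperZero : ∀ d {F G} → 3 ℕ.≤ d → F C.≉ C.0# → G C.≉ C.0# →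
    ∃ λ s → im s ≈ 0# × UpperZero d F (s ^ d C.* G)
  signedUpperZero d {F} {G} 3≤d F≉0 G≉0 = choose (halves d) 3≤d
    where
    z = target F G
    z≉0 : z C.≉ C.0#
    z≉0 eq = *-≉0 F≉0 (conj≉0 G≉0) (C.trans (C.sym (C.-‿involutive _)) (C.trans (C.-‿cong eq) C.-0#≈0#))

    s^d*G≉0 : ∀ {s} → s C.≉ C.0# → ∀ d → s ^ d C.* G C.≉ C.0#
    s^d*G≉0 s≉0 d = *-≉0 (^-≉0 s≉0 d) G≉0

    1≉0ℂ : C.1# C.≉ C.0#
    1≉0ℂ (p , _) = 1≉0 p

    -1≉0ℂ : C.- C.1# C.≉ C.0#
    -1≉0ℂ eq = 1≉0ℂ (C.trans (C.sym (C.-‿involutive C.1#)) (C.trans (C.-‿cong eq) C.-0#≈0#))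

    with-1 : ∀ d x → 0# < re (ray z (suc d) x) → im (ray z (suc d) x) ≈ 0# →
      ∃ λ s → im s ≈ 0# × UpperZero (suc d) F (s ^ suc d C.* G)
    with-1 d x 0<ρ im≈0 = C.1# , refl , rescale d (s^d*G≉0 1≉0ℂ (suc d))
      (target-cong (C.sym (C.trans (C.*-congʳ (1^n≈1 (suc d))) (C.*-identityˡ G)))) x 0<ρ im≈0

    -- In odd degree s = -1 replaces G by -G, hence the target z by -z, and a negative value of the
    -- ray becomes positive.
    with--1 : ∀ m x → re (ray z (suc (m ℕ.+ m)) x) < 0# → im (ray z (suc (m ℕ.+ m)) x) ≈ 0# →
      ∃ λ s → im s ≈ 0# × UpperZero (suc (m ℕ.+ m)) F (s ^ suc (m ℕ.+ m) C.* G)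
    with--1 m x ρ<0 im≈0 = C.- C.1# , R′.-0#≈0# , rescale (m ℕ.+ m) {z = C.- z} (s^d*G≉0 -1≉0ℂ (suc (m ℕ.+ m)))
        (C.trans (solve 2 (λ F cG → :- (:- (F :* cG)) := :- (F :* (:- cG))) C.refl F (conj G))
          (target-cong { F } {C.- G} (C.trans (solve 1 (λ G → :- G := (:- con (+ 1)) :* con (+ 1) :* G) C.refl G)
            (C.*-congʳ (C.*-congˡ (C.sym (^-double-neg m)))))))
        x (<-respʳ (proj₁ -ray) (x<0⇒0<-x ρ<0)) (trans (sym (proj₂ -ray)) (trans (-‿cong im≈0) R′.-0#≈0#))
      where
      import Algebra.Properties.Ring ring as R′
      -ray : C.- ray z (suc (m ℕ.+ m)) x C.≈ ray (C.- z) (suc (m ℕ.+ m)) x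
      -ray = C.-‿distribˡ-* z (upper x ^ suc (m ℕ.+ m))

    choose : ∀ {d} → Halves d → 3 ℕ.≤ d → ∃ λ s → im s ≈ 0# × UpperZero d F (s ^ d C.* G)
    -- In even degree s = -1 would change nothing, so positivity must come from doubling; d ≥ 3
    -- gives m ≥ 2, as `realPoint` requires.
    choose (even m@(suc (suc k))) _ =
      let (x , 0<ρ , im≈0) = positivePoint-double m (realPoint m (s≤s (s≤s z≤n))) z≉0
      in with-1 (suc k ℕ.+ m) x 0<ρ im≈0
    choose (odd m@(suc k)) _ = by-sign (realPoint (suc (m ℕ.+ m)) (s≤s (s≤s z≤n)) z)
      where
      by-sign : (∃ λ x → im (ray z (suc (m ℕ.+ m)) x) ≈ 0#) → ∃ λ s → im s ≈ 0# × UpperZero (suc (m ℕ.+ m)) F (s ^ suc (m ℕ.+ m) C.* G)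
      by-sign (x , im≈0) with <.compare 0# (re (ray z (suc (m ℕ.+ m)) x))
      ... | tri< 0<ρ _ _ = with-1 (m ℕ.+ m) x 0<ρ im≈0
      ... | tri≈ _ 0≈ρ _ = contradiction (sym 0≈ρ , im≈0) (ray-≉0 z≉0 (suc (m ℕ.+ m)) x)
      ... | tri> _ _ ρ<0 = with--1 m x ρ<0 im≈0
    choose (even 0) ()
    choose (even 1) (s≤s (s≤s ()))
    choose (odd 0) (s≤s ())

-- Splitting a non-mixed polynomial along τ I + s W.

module NonMixedPolynomials {c ℓ₁ ℓ₂} (R : CompleteOrderedField c ℓ₁ ℓ₂) where
  open CompleteOrderedField R hiding (zero)
  open OrderedField R
  open ComplexNumbers R
  open Monomials R
  open UpperZeros R
  open C using (_^_)

  δ : ∀ {n} → Matrix (ℂ R) n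
  δ i j = if does (i Fin.≟ j) then C.1# else C.0#

  diagonal-or-off : ∀ {n p} {P : Fin n → Fin n → Set p} →
    (∀ i → P i i) → (∀ {i j} → i ≢ j → P i j) → ∀ i j → P i j
  diagonal-or-off diag off i j with i Fin.≟ j
  ... | yes ≡.refl = diag i
  ... | no i≢j     = off i≢j

  δ-diag : ∀ {n} (i : Fin n) → δ i i C.≈ C.1#
  δ-diag i with i Fin.≟ i
  ... | yes _  = C.refl
  ... | no i≢i = contradiction ≡.refl i≢i

  δ-off : ∀ {n} {i j : Fin n} → i ≢ j → δ i j C.≈ C.0#
  δ-off {i = i} {j} i≢j with i Fin.≟ j
  ... | yes i≡j = contradiction i≡j i≢j
  ... | no _    = C.refl

  combination : ∀ {n} → ℂ R → ℂ R → Matrix (ℂ R) n → Matrix (ℂ R) n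
  combination τ s w i j = τ C.* δ i j C.+ s C.* w i j

  Hollow : ∀ {n} → Matrix (ℂ R) n → Set ℓ₁
  Hollow w = ∀ i → w i i C.≈ C.0#

  module _ {n} {w : Matrix (ℂ R) n} (hollow : Hollow w) (τ s : ℂ R) where

    combination-off : ∀ {i j} → i ≢ j → combination τ s w i j C.≈ s C.* w i j
    combination-off i≢j = C.trans (C.+-congʳ (C.trans (C.*-congˡ (δ-off i≢j)) (C.zeroʳ τ))) (C.+-identityˡ _)

    combination-diag : ∀ i → combination τ s w i i C.≈ τ C.* δ i i
    combination-diag i = C.trans (C.+-congˡ (C.trans (C.*-congˡ (hollow i)) (C.zeroʳ s))) (C.+-identityʳ _)

    -- A diagonal monomial sees only τ I and vanishes at w; an off-diagonal one sees only s w and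
    -- vanishes at the identity. The bound d ≥ 1 excludes the constant monomial, for which the two
    -- summands would count 1 twice.
    monomial-combination : ∀ α {d} → d ℕ.≥ 1 → degree α ≡ d → Diagonal α ⊎ OffDiagonal α →
      monomial R α (combination τ s w) C.≈ τ ^ d C.* monomial R α δ C.+ s ^ d C.* monomial R α w
    monomial-combination α d≥1 ≡.refl (inj₁ diagonal) = C.trans
      (monomial-scale α τ (diagonal-or-off (inj₂ ∘ combination-diag) (inj₁ ∘ diagonal _ _)))
      (C.sym (C.trans (C.+-congˡ (C.trans
        (C.*-congˡ (monomial-0 α d≥1 (diagonal-or-off (inj₂ ∘ hollow) (inj₁ ∘ diagonal _ _))))
        (C.zeroʳ _))) (C.+-identityʳ _)))
    monomial-combination α d≥1 ≡.refl (inj₂ (off-diagonal , _)) = C.trans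
      (monomial-scale α s (diagonal-or-off (inj₁ ∘ off-diagonal) (inj₂ ∘ combination-off)))
      (C.sym (C.trans (C.+-congʳ (C.trans
        (C.*-congˡ (monomial-0 α d≥1 (diagonal-or-off (inj₁ ∘ off-diagonal) (inj₂ ∘ δ-off))))
        (C.zeroʳ _))) (C.+-identityˡ _)))

    eval-combination : ∀ {d} (f : Polynomial R n) → d ℕ.≥ 1 → Homogeneous R d f → NonMixed R f →
      eval R f (combination τ s w) C.≈ τ ^ d C.* eval R f δ C.+ s ^ d C.* eval R f w
    eval-combination {d} f d≥1 homogeneous nonMixed = go (terms f) λ {a} {α} t∈f a≉0 →
        monomial-combination α d≥1 (homogeneous α (a , t∈f , a≉0)) (nonMixed α (a , t∈f , a≉0))
      where
      open IntegerCoefficients ℂ-commutativeRing using (solve; _:=_; _:+_; _:*_; con)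
      evalTerms : Terms n → Matrix (ℂ R) n → ℂ R
      evalTerms ts M = foldr (λ (a , α) s → a C.* monomial R α M C.+ s) C.0# ts
      Combines : Exponent n → Set ℓ₁
      Combines α = monomial R α (combination τ s w) C.≈ τ ^ d C.* monomial R α δ C.+ s ^ d C.* monomial R α w
      term : ∀ a α → (a C.≉ C.0# → Combines α) → a C.* monomial R α (combination τ s w) C.≈
        a C.* (τ ^ d C.* monomial R α δ C.+ s ^ d C.* monomial R α w)
      -- Homogeneity and non-mixedness speak only of nonzero coefficients, so a listed zero
      -- coefficient is treated separately: both sides are then 0.
      term a α combines with a ≈0?
      ... | yes a≈0 = C.trans (C.trans (C.*-congʳ a≈0) (C.zeroˡ _)) (C.sym (C.trans (C.*-congʳ a≈0) (C.zeroˡ _)))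
      ... | no a≉0  = C.*-congˡ (combines a≉0)
      go : ∀ ts → (∀ {a α} → (a , α) ∈ ts → a C.≉ C.0# → Combines α) →
        evalTerms ts (combination τ s w) C.≈ τ ^ d C.* evalTerms ts δ C.+ s ^ d C.* evalTerms ts w
      go [] _ = solve 2 (λ t s → con (+ 0) := t :* con (+ 0) :+ s :* con (+ 0)) C.refl (τ ^ d) (s ^ d)
      go ((a , α) ∷ ts) combines = C.trans
        (C.+-cong (term a α (combines (here ≡.refl))) (go ts (combines ∘ there)))
        (solve 7 (λ a t s x y p q → a :* (t :* x :+ s :* y) :+ (t :* p :+ s :* q)
                                 := t :* (a :* x :+ p) :+ s :* (a :* y :+ q)) C.refl
          a (τ ^ d) (s ^ d) (monomial R α δ) (monomial R α w) (evalTerms ts δ) (evalTerms ts w))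

    combination-symmetric : Symmetric R w → Symmetric R (combination τ s w)
    combination-symmetric sym-w = diagonal-or-off (λ _ → C.refl) λ {i} {j} i≢j →
      C.+-cong (C.*-congˡ (C.trans (δ-off i≢j) (C.sym (δ-off (i≢j ∘ ≡.sym))))) (C.*-congˡ (sym-w i j))

    combination-positive : 0# < im τ → im s ≈ 0# → (∀ i j → im (w i j) ≈ 0#) →
      PositiveDefinite R (Im R (combination τ s w))
    combination-positive 0<imτ im-s im-w x x≉0 = <-respʳ (sym (sum-cong-≋ {n} quadratic))
      (let (k , xk≉0) = Fin.¬∀⟶∃¬ n _ (λ i → x i <.≟ 0#) x≉0
       in sum-positive (λ i → 0≤-* (inj₁ 0<imτ) (0≤x² (x i))) k (*-positive 0<imτ (0<x² xk≉0)))
      where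
      open import Algebra.Properties.CommutativeMonoid.Sum +-commutativeMonoid using (sum; sum-cong-≋)
      open UpperFold +-commutativeMonoid using (sum-single)
      open IntegerCoefficients commutativeRing using (solve; _:=_; _:*_)
      M = combination τ s w
      off : ∀ {i j} → i ≢ j → im (M i j) ≈ 0#
      off {i} {j} i≢j = trans (proj₂ (combination-off i≢j))
        (trans (+-cong (trans (*-congˡ (im-w i j)) (zeroʳ _)) (trans (*-congʳ im-s) (zeroˡ _))) (+-identityˡ 0#))
      diag : ∀ i → im (M i i) ≈ im τ
      diag i = proj₂ (C.trans (combination-diag i) (C.trans (C.*-congˡ (δ-diag i)) (C.*-identityʳ τ)))
      quadratic : ∀ i → sum (λ j → x i * im (M i j) * x j) ≈ im τ * (x i * x i)
      quadratic i = trans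
        (sum-single i λ j j≢i → trans (*-congʳ (trans (*-congˡ (off (j≢i ∘ ≡.sym))) (zeroʳ (x i)))) (zeroˡ (x j)))
        (trans (*-congʳ (*-congˡ (diag i))) (solve 2 (λ x t → x :* t :* x := t :* (x :* x)) refl (x i) (im τ)))
      sum-nonneg : ∀ {m} {y : Fin m → Carrier} → (∀ i → 0# ≤ y i) → 0# ≤ sum y
      sum-nonneg {ℕ.zero}  0≤y = inj₂ refl
      sum-nonneg {ℕ.suc m} 0≤y = 0≤-+ (0≤y Fin.zero) (sum-nonneg (0≤y ∘ Fin.suc))
      sum-positive : ∀ {m} {y : Fin m → Carrier} → (∀ i → 0# ≤ y i) → ∀ k → 0# < y k → 0# < sum y
      sum-positive 0≤y Fin.zero    0<yk = 0<-+ 0<yk (sum-nonneg (0≤y ∘ Fin.suc))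
      sum-positive 0≤y (Fin.suc k) 0<yk =
        <-respʳ (+-comm _ _) (0<-+ (sum-positive (0≤y ∘ Fin.suc) k 0<yk) (0≤y Fin.zero))

  -- Restriction to real symmetric matrices with zero diagonal.

  hollowed : ∀ {n} → Matrix (ℂ R) n → Matrix (ℂ R) n
  hollowed X i j = if does (i Fin.≟ j) then C.0# else X i j

  hollowed-hollow : ∀ {n} (X : Matrix (ℂ R) n) → Hollow (hollowed X)
  hollowed-hollow X i with i Fin.≟ i
  ... | yes _  = C.refl
  ... | no i≢i = contradiction ≡.refl i≢i

  hollowed-off : ∀ {n} (X : Matrix (ℂ R) n) {i j} → i ≢ j → hollowed X i j C.≈ X i j
  hollowed-off X {i} {j} i≢j with i Fin.≟ j
  ... | yes i≡j = contradiction i≡j i≢j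
  ... | no _    = C.refl

  -- Independence tests a relation at arbitrary real matrices, stability only at symmetric ones.
  -- Reflecting the upper triangle bridges the two without changing any monomial.
  symmetrised : ∀ {n} → Matrix Carrier n → Matrix (ℂ R) n
  symmetrised u i j = real (if does (i Fin.≤? j) then u i j else u j i)

  symmetrised-upper : ∀ {n} (u : Matrix Carrier n) {i j} → i ≤ᶠ j → symmetrised u i j C.≈ real (u i j)
  symmetrised-upper u {i} {j} i≤j = at (i Fin.≤? j)
    where
    at : (i≤?j : Dec (i ≤ᶠ j)) → real (if does i≤?j then u i j else u j i) C.≈ real (u i j)
    at (yes _)  = C.refl
    at (no i≰j) = contradiction i≤j i≰j

  symmetrised-symmetric : ∀ {n} (u : Matrix Carrier n) → Symmetric R (symmetrised u)
  symmetrised-symmetric u i j = at (i Fin.≤? j) (j Fin.≤? i)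
    where
    at : (i≤?j : Dec (i ≤ᶠ j)) (j≤?i : Dec (j ≤ᶠ i)) →
      real (if does i≤?j then u i j else u j i) C.≈ real (if does j≤?i then u j i else u i j)
    at (yes i≤j) (yes j≤i) with ≡.refl ← Fin.≤-antisym i≤j j≤i = C.refl
    at (yes _)   (no _)    = C.refl
    at (no _)    (yes _)   = C.refl
    at (no i≰j)  (no j≰i)  = contradiction (Fin.≤-total i j) [ i≰j , j≰i ]′

  -- As 0^0 = 1, the value is 1 if no diagonal variable occurs and 0 otherwise. Restricted to
  -- zero-diagonal matrices, distinct monomials may coincide as functions, since all those with a
  -- diagonal variable vanish; recording this in a weight keeps the characters themselves distinct.
  off-indicator : ∀ {n} → Exponent n → ℂ R
  off-indicator α = monomial R α (hollowed λ _ _ → C.1#)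

  off-indicator-OffDiagonal : ∀ {n} (α : Exponent n) → OffDiagonal α → off-indicator α C.≈ C.1#
  off-indicator-OffDiagonal α (off-diagonal , _) = C.trans
    (monomial-scale α C.1# (diagonal-or-off (inj₁ ∘ off-diagonal)
      (λ i≢j → inj₂ (C.trans (hollowed-off (λ _ _ → C.1#) i≢j) (C.sym (C.*-identityˡ C.1#))))))
    (C.trans (C.*-cong (1^n≈1 (degree α)) (character-1 α)) (C.*-identityˡ C.1#))

  -- On the upper triangle the hollowed matrix is the entrywise product of the hollow all-ones
  -- matrix and u, so each monomial factors into its weight and its character.
  eval-hollowed : ∀ {n} (f : Polynomial R n) u → eval R f (hollowed (symmetrised u)) C.≈ weightedSum (terms f) off-indicator u
  eval-hollowed f u = go (terms f)
    where
    upper-entry : ∀ i j → i ≤ᶠ j → hollowed (symmetrised u) i j C.≈ hollowed (λ _ _ → C.1#) i j C.* real (u i j)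
    upper-entry = diagonal-or-off
      (λ i _ → C.trans (hollowed-hollow (symmetrised u) i)
        (C.sym (C.trans (C.*-congʳ (hollowed-hollow (λ _ _ → C.1#) i)) (C.zeroˡ _))))
      (λ i≢j i≤j → C.trans (hollowed-off (symmetrised u) i≢j) (C.trans (symmetrised-upper u i≤j)
        (C.sym (C.trans (C.*-congʳ (hollowed-off (λ _ _ → C.1#) i≢j)) (C.*-identityˡ _)))))
    go : ∀ ts → foldr (λ (a , α) s → a C.* monomial R α (hollowed (symmetrised u)) C.+ s) C.0# ts
              C.≈ weightedSum ts off-indicator u
    go [] = C.refl
    go ((a , α) ∷ ts) = C.+-cong
      (C.trans (C.*-congˡ (monomial-* α {M = hollowed λ _ _ → C.1#} {N = λ i j → real (u i j)} upper-entry)) (C.sym (C.*-assoc a (off-indicator α) (character α u)))) (go ts)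

  module _ {n d} (f : Polynomial R n) (homogeneous : Homogeneous R d f) (nonMixed : NonMixed R f) (d≥3 : d ℕ.≥ 3)
           (stable : PsdStable R f) where

    eval-real-hollow : ∀ {w} → Hollow w → Symmetric R w → (∀ i j → im (w i j) ≈ 0#) → eval R f w C.≈ C.0#
    eval-real-hollow {w} hollow sym-w im-w with eval R f w ≈0?
    ... | yes G≈0 = G≈0
    ... | no G≉0 = ⊥-elim (let (s , im-s , upperZero τ 0<imτ isZero) = signedUpperZero d d≥3 F≉0 G≉0
                           in nonvanishing τ s 0<imτ im-s isZero)
      where
      d≥1 : d ℕ.≥ 1
      d≥1 = ℕ.≤-trans (s≤s z≤n) d≥3
      F = eval R f δ
      nonvanishing : ∀ τ s → 0# < im τ → im s ≈ 0# → τ ^ d C.* F C.+ s ^ d C.* eval R f w C.≉ C.0#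
      nonvanishing τ s 0<imτ im-s eq = stable (combination τ s w) (combination-symmetric hollow τ s sym-w)
        (combination-positive hollow τ s 0<imτ im-s im-w)
        (C.trans (eval-combination hollow τ s f d≥1 homogeneous nonMixed) eq)
      F≉0 : F C.≉ C.0#
      -- With s = 0 and τ = i the combination is i I, where f takes the value iᵈ F.
      F≉0 F≈0 = nonvanishing (0# +i 1#) C.0# 0<1 refl (C.trans
        (C.+-cong (C.trans (C.*-congˡ F≈0) (C.zeroʳ _)) (C.trans (C.*-congʳ (0^n≈0 d≥1)) (C.zeroˡ _)))
        (C.+-identityˡ C.0#))

    -- Vanishing at all real hollow symmetric matrices kills every weighted coefficient; the weight
    -- is 1 on off-diagonal exponents, so there the coefficient itself is 0.
    off-diagonal-coefficients-vanish : ∀ {b β} → OffDiagonal β → (b , β) ∈ terms f → b C.≈ C.0#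
    off-diagonal-coefficients-vanish {b} {β} off b∈f = C.trans
      (C.sym (C.trans (C.*-congˡ (off-indicator-OffDiagonal β off)) (C.*-identityʳ b)))
      (characters-independent (terms f) (distinct f) off-indicator
        (λ u → C.trans (C.sym (eval-hollowed f u)) (eval-real-hollow
          (hollowed-hollow (symmetrised u))
          (diagonal-or-off (λ _ → C.refl) λ {i} {j} i≢j → C.trans (hollowed-off (symmetrised u) i≢j)
            (C.trans (symmetrised-symmetric u i j) (C.sym (hollowed-off (symmetrised u) (i≢j ∘ ≡.sym)))))
          (diagonal-or-off (λ i → proj₂ (hollowed-hollow (symmetrised u) i))
            (λ i≢j → proj₂ (hollowed-off (symmetrised u) i≢j)))))
        b∈f)

theorem5p4 : ∀ {c ℓ₁ ℓ₂} (R : CompleteOrderedField c ℓ₁ ℓ₂) (n d : ℕ) (f : Polynomial R n) →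
    Homogeneous R d f → NonMixed R f → d ≥ 3 →
    (∃ λ β → OffDiagonal β × Occurs R β f) →
    ¬ PsdStable R f
theorem5p4 R n d f homogeneous nonMixed d≥3 (β , off , b , b∈f , b≉0) stable =
  b≉0 (off-diagonal-coefficients-vanish f homogeneous nonMixed d≥3 stable off b∈f)
  where open NonMixedPolynomials R
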